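{- Consider any algorithm for the Uniform Cost-Distance Steiner Tree Problem that works by sub-dividing a minimum-length Steiner tree into components and then reconnects the components with edges from the root directly to one vertex in each component. Then this algorithm does not have an approximation ratio better than $\frac{3}{2}$.
   Context: An instance $(M,c,T,r,p,w)$ of the Uniform Cost-Distance Steiner Tree Problem consists of a metric space $(M,c)$, a root $r$, a finite set $T$ of sinks (terminals) with $r\notin T$, a map $p:T\,\dot\cup\,\{r\}\to M$, and sink delay weights $w:T\to\mathbb{R}_{\ge 0}$. A Steiner tree for $T\cup\{r\}$ is a finite tree $A$ with $T\cup\{r\}\subseteq V(A)$, together with an extension of $p$ to $V(A)\setminus(T\cup\{r\})$ with values in $M$. Write $c(x,y):=c(p(x),p(y))$ for vertices $x,y$ and $c(e):=c(x,y)$ for an edge $e=\{x,y\}$. The total cost of a Steiner tree $A$ is $$\sum_{e\in E(A)} c(e)+\sum_{t\in T} w(t)\sum_{e\in E(A_{[r,t]})} c(e),$$ where $A_{[r,t]}$ is the unique $r$-$t$-path in $A$. The task is to compute a Steiner tree for $T\cup\{r\}$ of minimum total cost. A minimum-length Steiner tree is a Steiner tree $A$ for $T\cup\{r\}$ minimizing $\sum_{e\in E(A)} c(e)$. An algorithm of the considered kind takes a minimum-length Steiner tree for $T\cup\{r\}$, cuts it into several components by deleting edges, and then reconnects each component that no longer contains the root $r$ by an edge from $r$ directly to one vertex of that component; the resulting tree is its output. An algorithm has approximation ratio $\alpha$ if, for every instance, the total cost of its output is at most $\alpha$ times the minimum total cost. -}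

module Defs where

open import Data.Fin.Base using (Fin)
open import Data.List.Base using (List; []; _∷_; _++_; map; foldr; length; allFin)
open import Data.List.Membership.Propositional using (_∈_)
open import Data.List.Relation.Binary.Permutation.Propositional using (_↭_)
open import Data.List.Relation.Unary.All using (All)
open import Data.List.Relation.Unary.AllPairs using (AllPairs)
open import Data.List.Relation.Unary.Unique.Propositional using (Unique)
open import Data.Nat.Base as ℕ using (ℕ)
import Data.Nat.Properties as ℕ
import Data.Integer.Base as ℤ
open import Data.Product.Base using (Σ; ∃; _×_; _,_; proj₁; proj₂)
open import Data.Rational.Base
  using (ℚ; 0ℚ; 1ℚ; ½; _/_; _+_; _*_; _-_; ∣_∣; _≤_; _<_; 1/_;
         NonZero; Positive; positive; nonNegative)
open import Data.Rational.Properties as ℚ using (module ≤-Reasoning)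
open import Data.Rational.Solver using (module +-*-Solver)
open import Data.Sum.Base using (_⊎_)
open import Function.Metric.Structures using (IsGeneralMetric)
open import Relation.Binary.Construct.Closure.ReflexiveTransitive using (Star; ε; _◅_)
open import Relation.Binary.PropositionalEquality.Core
  using (_≡_; _≢_; refl; sym; trans; cong)
open import Relation.Binary.Structures using (IsPartialOrder)
open import Relation.Nullary.Negation.Core using (¬_)

------------------------------------------------------------------------
-- Real numbers as Cauchy sequences of rationals, compared up to _≈ℝ_

Eventually : (ℕ → Set) → Set
Eventually P = ∃ λ N → ∀ n → N ℕ.≤ n → P n

IsCauchy : (ℕ → ℚ) → Set
IsCauchy x = ∀ e → 0ℚ < e →
  ∃ λ N → ∀ m n → N ℕ.≤ m → N ℕ.≤ n → ∣ x m - x n ∣ ≤ e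

record ℝ : Set where
  constructor mkℝ
  field
    seq    : ℕ → ℚ
    cauchy : IsCauchy seq

open ℝ public

infix 4 _≤ℝ_ _<ℝ_ _≈ℝ_

_≤ℝ_ : ℝ → ℝ → Set
x ≤ℝ y = ∀ e → 0ℚ < e → Eventually λ n → seq x n ≤ seq y n + e

_<ℝ_ : ℝ → ℝ → Set
x <ℝ y = ∃ λ e → 0ℚ < e × Eventually λ n → seq x n + e ≤ seq y n

_≈ℝ_ : ℝ → ℝ → Set
x ≈ℝ y = x ≤ℝ y × y ≤ℝ x

private
  half : ℚ → ℚ
  half e = e * ½

  half+half : ∀ e → half e + half e ≡ e
  half+half e = trans (sym (ℚ.*-distribˡ-+ e ½ ½)) (ℚ.*-identityʳ e)

  half-pos : ∀ {e} → 0ℚ < e → 0ℚ < half e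
  half-pos {e} e>0 =
    ℚ.positive⁻¹ (half e) {{ℚ.pos*pos⇒pos e {{positive e>0}} ½}}

  e>0⇒x≤x+e : ∀ x {e} → 0ℚ < e → x ≤ x + e
  e>0⇒x≤x+e x e>0 =
    ℚ.≤-trans (ℚ.≤-reflexive (sym (ℚ.+-identityʳ x))) (ℚ.+-monoʳ-≤ x (ℚ.<⇒≤ e>0))

≤ℝ-refl : ∀ {x} → x ≤ℝ x
≤ℝ-refl {x} e e>0 = 0 , λ n _ → e>0⇒x≤x+e (seq x n) e>0

≤ℝ-trans : ∀ {x y z} → x ≤ℝ y → y ≤ℝ z → x ≤ℝ z
≤ℝ-trans {x} {y} {z} x≤y y≤z e e>0
  with x≤y (half e) (half-pos e>0) | y≤z (half e) (half-pos e>0)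
... | N₁ , p | N₂ , q = N₁ ℕ.⊔ N₂ , λ n N≤n → begin
  seq x n                        ≤⟨ p n (ℕ.≤-trans (ℕ.m≤m⊔n N₁ N₂) N≤n) ⟩
  seq y n + half e               ≤⟨ ℚ.+-monoˡ-≤ (half e) (q n (ℕ.≤-trans (ℕ.m≤n⊔m N₁ N₂) N≤n)) ⟩
  (seq z n + half e) + half e    ≡⟨ ℚ.+-assoc (seq z n) (half e) (half e) ⟩
  seq z n + (half e + half e)    ≡⟨ cong (seq z n +_) (half+half e) ⟩
  seq z n + e                    ∎
  where open ≤-Reasoning

≤ℝ-isPartialOrder : IsPartialOrder _≈ℝ_ _≤ℝ_
≤ℝ-isPartialOrder = record
  { isPreorder = record
    { isEquivalence = record
      { refl  = λ {x} → ≤ℝ-refl {x} , ≤ℝ-refl {x}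
      ; sym   = λ (p , q) → q , p
      ; trans = λ {x} {y} {z} (p , q) (p′ , q′) →
          ≤ℝ-trans {x} {y} {z} p p′ , ≤ℝ-trans {z} {y} {x} q′ q
      }
    ; reflexive = proj₁
    ; trans     = λ {x} {y} {z} → ≤ℝ-trans {x} {y} {z}
    }
  ; antisym = _,_
  }

fromℚ : ℚ → ℝ
fromℚ q = mkℝ (λ _ → q) λ e e>0 → 0 , λ _ _ _ _ →
  ℚ.≤-trans (ℚ.≤-reflexive (cong ∣_∣ (ℚ.+-inverseʳ q))) (ℚ.<⇒≤ e>0)

0ℝ : ℝ
0ℝ = fromℚ 0ℚ

infixl 6 _+ℝ_
infixl 7 _*ℝ_

_+ℝ_ : ℝ → ℝ → ℝ
mkℝ x x-cauchy +ℝ mkℝ y y-cauchy = mkℝ (λ n → x n + y n) sum-cauchy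
  where
  open +-*-Solver
  rearrange : ∀ a b c d → (a + b) - (c + d) ≡ (a - c) + (b - d)
  rearrange = solve 4 (λ a b c d →
    (a :+ b) :- (c :+ d) := (a :- c) :+ (b :- d)) refl

  sum-cauchy : IsCauchy (λ n → x n + y n)
  sum-cauchy e e>0
    with x-cauchy (half e) (half-pos e>0) | y-cauchy (half e) (half-pos e>0)
  ... | N₁ , p | N₂ , q = N₁ ℕ.⊔ N₂ , λ m n N≤m N≤n → begin
    ∣ (x m + y m) - (x n + y n) ∣      ≡⟨ cong ∣_∣ (rearrange (x m) (y m) (x n) (y n)) ⟩
    ∣ (x m - x n) + (y m - y n) ∣      ≤⟨ ℚ.∣p+q∣≤∣p∣+∣q∣ (x m - x n) (y m - y n) ⟩
    ∣ x m - x n ∣ + ∣ y m - y n ∣      ≤⟨ ℚ.+-mono-≤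
                                            (p m n (ℕ.m⊔n≤o⇒m≤o N₁ N₂ N≤m) (ℕ.m⊔n≤o⇒m≤o N₁ N₂ N≤n))
                                            (q m n (ℕ.m⊔n≤o⇒n≤o N₁ N₂ N≤m) (ℕ.m⊔n≤o⇒n≤o N₁ N₂ N≤n)) ⟩
    half e + half e                    ≡⟨ half+half e ⟩
    e                                  ∎
    where open ≤-Reasoning

private
  bounded : ∀ {x} → IsCauchy x →
            ∃ λ B → 0ℚ < B × Eventually λ n → ∣ x n ∣ ≤ B
  bounded {x} x-cauchy with x-cauchy 1ℚ (ℚ.positive⁻¹ 1ℚ)
  ... | N , p = 1ℚ + ∣ x N ∣ , B>0 , N , λ n N≤n → begin
    ∣ x n ∣                    ≡⟨ cong ∣_∣ (split (x n) (x N)) ⟩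
    ∣ (x n - x N) + x N ∣      ≤⟨ ℚ.∣p+q∣≤∣p∣+∣q∣ (x n - x N) (x N) ⟩
    ∣ x n - x N ∣ + ∣ x N ∣    ≤⟨ ℚ.+-monoˡ-≤ ∣ x N ∣ (p n N N≤n ℕ.≤-refl) ⟩
    1ℚ + ∣ x N ∣               ∎
    where
    open ≤-Reasoning
    open +-*-Solver
    split : ∀ a b → a ≡ (a - b) + b
    split = solve 2 (λ a b → a := (a :- b) :+ b) refl
    B>0 : 0ℚ < 1ℚ + ∣ x N ∣
    B>0 = ℚ.positive⁻¹ (1ℚ + ∣ x N ∣)
            {{ℚ.pos+nonNeg⇒pos 1ℚ ∣ x N ∣ {{ℚ.∣-∣-nonNeg (x N)}}}}

  divide : ∀ {C e} → 0ℚ < C → 0ℚ < e → ∃ λ d → 0ℚ < d × C * d ≡ e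
  divide {C} {e} C>0 e>0 =
    1/C * e
    , ℚ.positive⁻¹ (1/C * e) {{ℚ.pos*pos⇒pos 1/C {{ℚ.1/pos⇒pos C}} e {{positive e>0}}}}
    , trans (sym (ℚ.*-assoc C 1/C e))
        (trans (cong (_* e) (ℚ.*-inverseʳ C)) (ℚ.*-identityˡ e))
    where
    instance
      C-pos : Positive C
      C-pos = positive C>0
      C-nonZero : NonZero C
      C-nonZero = ℚ.pos⇒nonZero C
    1/C : ℚ
    1/C = 1/ C

_*ℝ_ : ℝ → ℝ → ℝ
mkℝ x x-cauchy *ℝ mkℝ y y-cauchy = mkℝ (λ n → x n * y n) product-cauchy
  where
  open +-*-Solver
  rearrange : ∀ a b c d → a * b - c * d ≡ a * (b - d) + d * (a - c)
  rearrange = solve 4 (λ a b c d →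
    a :* b :- c :* d := a :* (b :- d) :+ d :* (a :- c)) refl

  *-mono-∣∣ : ∀ a b A B → 0ℚ < B → ∣ a ∣ ≤ A → ∣ b ∣ ≤ B → ∣ a * b ∣ ≤ A * B
  *-mono-∣∣ a b A B B>0 a≤A b≤B = begin
    ∣ a * b ∣        ≡⟨ ℚ.∣p*q∣≡∣p∣*∣q∣ a b ⟩
    ∣ a ∣ * ∣ b ∣    ≤⟨ ℚ.*-monoˡ-≤-nonNeg ∣ a ∣ {{ℚ.∣-∣-nonNeg a}} b≤B ⟩
    ∣ a ∣ * B        ≤⟨ ℚ.*-monoʳ-≤-nonNeg B {{nonNegative (ℚ.<⇒≤ B>0)}} a≤A ⟩
    A * B            ∎
    where open ≤-Reasoning

  bound : ∀ {e A B d} → 0ℚ < d → (A + B) * d ≡ e → ∀ a b a′ b′ →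
          ∣ a ∣ ≤ A → ∣ b′ ∣ ≤ B → ∣ a - a′ ∣ ≤ d → ∣ b - b′ ∣ ≤ d →
          ∣ a * b - a′ * b′ ∣ ≤ e
  bound {e} {A} {B} {d} d>0 C*d≡e a b a′ b′ a≤A b′≤B a-a′≤d b-b′≤d = begin
    ∣ a * b - a′ * b′ ∣                      ≡⟨ cong ∣_∣ (rearrange a b a′ b′) ⟩
    ∣ a * (b - b′) + b′ * (a - a′) ∣         ≤⟨ ℚ.∣p+q∣≤∣p∣+∣q∣ (a * (b - b′)) (b′ * (a - a′)) ⟩
    ∣ a * (b - b′) ∣ + ∣ b′ * (a - a′) ∣     ≤⟨ ℚ.+-mono-≤ {∣ a * (b - b′) ∣} {A * d}
                                                  {∣ b′ * (a - a′) ∣} {B * d}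
                                                  (*-mono-∣∣ a (b - b′) A d d>0 a≤A b-b′≤d)
                                                  (*-mono-∣∣ b′ (a - a′) B d d>0 b′≤B a-a′≤d) ⟩
    A * d + B * d                            ≡⟨ sym (ℚ.*-distribʳ-+ d A B) ⟩
    (A + B) * d                              ≡⟨ C*d≡e ⟩
    e                                        ∎
    where open ≤-Reasoning

  product-cauchy : IsCauchy (λ n → x n * y n)
  product-cauchy e e>0 =
    let A , A>0 , Nx , boundx = bounded x-cauchy
        B , B>0 , Ny , boundy = bounded y-cauchy
        d , d>0 , C*d≡e = divide {A + B} {e} (ℚ.+-mono-< {0ℚ} {A} {0ℚ} {B} A>0 B>0) e>0
        Mx , closex = x-cauchy d d>0
        My , closey = y-cauchy d d>0
        N = Nx ℕ.⊔ Ny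
        M = Mx ℕ.⊔ My
    in N ℕ.⊔ M , λ m n N⊔M≤m N⊔M≤n →
      let N≤m = ℕ.m⊔n≤o⇒m≤o N M N⊔M≤m
          N≤n = ℕ.m⊔n≤o⇒m≤o N M N⊔M≤n
          M≤m = ℕ.m⊔n≤o⇒n≤o N M N⊔M≤m
          M≤n = ℕ.m⊔n≤o⇒n≤o N M N⊔M≤n
      in bound {e} {A} {B} {d} d>0 C*d≡e (x m) (y m) (x n) (y n)
           (boundx m (ℕ.m⊔n≤o⇒m≤o Nx Ny N≤m))
           (boundy n (ℕ.m⊔n≤o⇒n≤o Nx Ny N≤n))
           (closex m n (ℕ.m⊔n≤o⇒m≤o Mx My M≤m) (ℕ.m⊔n≤o⇒m≤o Mx My M≤n))
           (closey m n (ℕ.m⊔n≤o⇒n≤o Mx My M≤m) (ℕ.m⊔n≤o⇒n≤o Mx My M≤n))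

sumℝ : List ℝ → ℝ
sumℝ = foldr _+ℝ_ 0ℝ

3/2ℝ : ℝ
3/2ℝ = fromℚ (ℤ.+ 3 / 2)

record MetricSpace : Set₁ where
  infix 4 _≈_
  field
    Carrier  : Set
    _≈_      : Carrier → Carrier → Set
    dist     : Carrier → Carrier → ℝ
    isMetric : IsGeneralMetric _≈_ _≈ℝ_ _≤ℝ_ 0ℝ _+ℝ_ dist

------------------------------------------------------------------------
-- Finite simple graphs: an undirected edge is listed exactly once, in
-- one of its two orientations.

module _ {V : Set} where

  SameEdge : V × V → V × V → Set
  SameEdge (a , b) (c , d) = (a ≡ c × b ≡ d) ⊎ (a ≡ d × b ≡ c)

  Adjacent : List (V × V) → V → V → Set
  Adjacent E u v = (u , v) ∈ E ⊎ (v , u) ∈ E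

  Walk : List (V × V) → V → V → Set
  Walk E = Star (Adjacent E)

  vertices : ∀ {E u v} → Walk E u v → List V
  vertices {u = u} ε       = u ∷ []
  vertices {u = u} (_ ◅ p) = u ∷ vertices p

  Path : List (V × V) → V → V → Set
  Path E u v = Σ (Walk E u v) λ p → Unique (vertices p)

  record IsTree (E : List (V × V)) : Set where
    field
      loopless   : All (λ (u , v) → u ≢ v) E
      noParallel : AllPairs (λ e f → ¬ SameEdge e f) E
      connected  : ∀ u v → Path E u v
      -- A cycle is a path on at least three vertices closed up by an edge.
      acyclic    : ∀ {u v} (p : Path E u v) →
                   3 ℕ.≤ length (vertices (proj₁ p)) → ¬ Adjacent E v u

------------------------------------------------------------------------
-- The Uniform Cost-Distance Steiner Tree Problem

record Instance : Set₁ where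
  field
    space   : MetricSpace
    #sinks  : ℕ
  open MetricSpace space public
  field
    rootPos  : Carrier
    sinkPos  : Fin #sinks → Carrier
    weight   : Fin #sinks → ℝ
    weight≥0 : ∀ t → 0ℝ ≤ℝ weight t

data Vertex (n m : ℕ) : Set where
  root    : Vertex n m
  sink    : Fin n → Vertex n m
  steiner : Fin m → Vertex n m

module _ (I : Instance) where
  open Instance I

  record SteinerTree : Set where
    field
      #steiner   : ℕ
      steinerPos : Fin #steiner → Carrier
      edges      : List (Vertex #sinks #steiner × Vertex #sinks #steiner)
      isTree     : IsTree edges

    open IsTree isTree public

    pos : Vertex #sinks #steiner → Carrier
    pos root        = rootPos
    pos (sink t)    = sinkPos t
    pos (steiner s) = steinerPos s

    cost : Vertex #sinks #steiner → Vertex #sinks #steiner → ℝ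
    cost u v = dist (pos u) (pos v)

    treeLength : ℝ
    treeLength = sumℝ (map (λ (u , v) → cost u v) edges)

    walkLength : ∀ {u v} → Walk edges u v → ℝ
    walkLength ε                   = 0ℝ
    walkLength (_◅_ {u} {v} _ p) = cost u v +ℝ walkLength p

    -- By acyclicity, the path supplied by connectedness is the only one.
    rootPath : ∀ t → Path edges root (sink t)
    rootPath t = connected root (sink t)

    totalCost : ℝ
    totalCost = treeLength +ℝ
      sumℝ (map (λ t → weight t *ℝ walkLength (proj₁ (rootPath t))) (allFin #sinks))

  open SteinerTree using (treeLength; totalCost)

  IsMinimumLength : SteinerTree → Set
  IsMinimumLength A = ∀ B → treeLength A ≤ℝ treeLength B

  IsOptimal : SteinerTree → Set
  IsOptimal A = ∀ B → totalCost A ≤ℝ totalCost B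

  MinimumLengthSteinerTree : Set
  MinimumLengthSteinerTree = Σ SteinerTree IsMinimumLength

  record SubdivideAndReconnect : Set where
    field
      tree            : SteinerTree
      isMinimumLength : IsMinimumLength tree
    open SteinerTree tree public
    field
      deleted kept : List (Vertex #sinks #steiner × Vertex #sinks #steiner)
      subdivision  : edges ↭ deleted ++ kept

      -- One representative of every component of the subdivided tree that
      -- does not contain the root, and no other vertices.
      reconnected  : List (Vertex #sinks #steiner)
      nonRoot      : All (λ s → ¬ Walk kept root s) reconnected
      atMostOne    : AllPairs (λ s s′ → ¬ Walk kept s s′) reconnected
      atLeastOne   : ∀ v → ¬ Walk kept root v →
                     ∃ λ s → s ∈ reconnected × Walk kept s v

    outputEdges : List (Vertex #sinks #steiner × Vertex #sinks #steiner)
    outputEdges = kept ++ map (root ,_) reconnected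

    -- This always holds; having it as a field only provides the witness
    -- from which the output is built as a Steiner tree.
    field
      outputIsTree : IsTree outputEdges

    output : SteinerTree
    output = record
      { #steiner   = #steiner
      ; steinerPos = steinerPos
      ; edges      = outputEdges
      ; isTree     = outputIsTree
      }

-- In an infinite metric space a minimum-length Steiner tree need not exist,
-- so an algorithm has to answer only when one does.  It is free to subdivide
-- a different minimum-length Steiner tree than the one it is given.
SubdivisionAlgorithm : Set₁
SubdivisionAlgorithm =
  (I : Instance) → MinimumLengthSteinerTree I → SubdivideAndReconnect I

HasApproximationRatio : SubdivisionAlgorithm → ℝ → Set₁
HasApproximationRatio alg α =
  (I : Instance) (A : MinimumLengthSteinerTree I) (B : SteinerTree I) →
  IsOptimal I B →
  SteinerTree.totalCost (SubdivideAndReconnect.output (alg I A))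
    ≤ℝ α *ℝ SteinerTree.totalCost B

{-# OPTIONS --safe #-}

-- Around the root lie n = K² sinks, all at distance D = a (K + 1) from it.
-- Consecutive sinks are at distance a, all other pairs of sinks at distance
-- a + 1, and every weight is 1/K.  A minimum-length tree only uses root edges
-- and edges of length a, hence so does its subdivision.  If the output has m
-- root edges, its length is at least m D + (n − m) a = m K a + n a.  A path to
-- sink t has length at least D + a (K − Σ (K − |t − s|)⁺) over the ends s of
-- the root edges, and Σ_t (K − |t − s|)⁺ ≤ K² for each s.  So the total cost is
-- at least 3 n a: what the m root edges cost is exactly what they can save.
-- The star centred at one sink costs about 2 n a when K = a is large.
--
-- Costs of trees in these instances are natural numbers (all distances are
-- scaled by K to this end), so an optimal tree cannot fail to exist, which is all that a negated conclusion needs.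

module Submission where

open import Defs
open import Relation.Nullary.Negation.Core using (¬_)

open import Data.Fin.Base using (Fin; zero; suc; toℕ; inject₁)
open import Data.Fin.Induction using (<-weakInduction)
import Data.Fin.Properties as Fin
import Data.Integer.Base as ℤ
import Data.Integer.Properties as ℤ
open import Data.List.Base using (List; []; _∷_; _++_; map; length; allFin; filter; tabulate)
import Data.List.Membership.DecPropositional as DecMembership
open import Data.List.Membership.Propositional using (_∈_)
open import Data.List.Membership.Propositional.Properties
  using (∈-∃++; ∈-++⁻; ∈-++⁺ˡ; ∈-++⁺ʳ; ∈-tabulate⁺; ∈-map⁺)
open import Data.List.Properties
  using (length-++; length-map; length-tabulate; map-++; map-cong; map-∘; map-tabulate; filter-all)
open import Data.List.Relation.Binary.Permutation.Propositional.Properties using (map⁺)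
open import Data.List.Relation.Unary.All as All using (All; []; _∷_)
import Data.List.Relation.Unary.All.Properties as All
open import Data.List.Relation.Unary.AllPairs using ([]; _∷_)
import Data.List.Relation.Unary.AllPairs.Properties as AllPairs
open import Data.List.Relation.Unary.Any using (here; there)
open import Data.List.Relation.Unary.Unique.Propositional using (Unique)
import Data.List.Relation.Unary.Unique.Propositional.Properties as Unique
open import Data.Maybe.Base using (Maybe; just; nothing)
open import Data.Maybe.Properties using (just-injective; ≡-dec)
open import Data.Nat.Base
  using (ℕ; zero; suc; pred; _+_; _*_; _∸_; _⊓_; _⊔_; ∣_-_∣; _≤_; _<_; z≤n; s≤s)
open import Data.Nat.Induction using (<-wellFounded)
open import Data.Nat.ListAction using (sum)
open import Data.Nat.ListAction.Properties using (sum-++; sum-↭)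
open import Data.Nat.Properties
open import Data.Nat.Solver using (module +-*-Solver)
open import Data.Product.Base using (Σ; ∃; _×_; _,_; proj₁; proj₂; uncurry)
open import Data.Rational.Base as ℚ using (ℚ; mkℚ; 0ℚ; 1ℚ; ½; 1/_)
open import Data.Rational.Literals using (fromℤ)
import Data.Rational.Properties as ℚ
import Data.Rational.Solver as ℚ
import Data.Rational.Unnormalised.Base as ℚᵘ
import Data.Rational.Unnormalised.Properties as ℚᵘ
open import Data.Sum.Base using (_⊎_; inj₁; inj₂; swap; [_,_])
open import Function.Base using (_∘_; id)
open import Induction.WellFounded using (Acc; acc)
open import Relation.Binary.Construct.Closure.ReflexiveTransitive using (ε; _◅_; _◅◅_; reverse)
open import Relation.Binary.Definitions using (DecidableEquality)
open import Relation.Binary.PropositionalEquality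
  using (_≡_; _≢_; refl; sym; trans; cong; cong₂; subst; isEquivalence; module ≡-Reasoning)
open import Relation.Nullary.Decidable using (yes; no; ¬?; map′)
open import Relation.Nullary.Negation.Core using (contradiction)

-- Finite sums

∑ : ∀ {A : Set} → (A → ℕ) → List A → ℕ
∑ f xs = sum (map f xs)

module _ {A : Set} where

  ∑-mono : ∀ {f g : A → ℕ} → (∀ x → f x ≤ g x) → ∀ xs → ∑ f xs ≤ ∑ g xs
  ∑-mono f≤g []       = z≤n
  ∑-mono f≤g (x ∷ xs) = +-mono-≤ (f≤g x) (∑-mono f≤g xs)

  ∑-cong : ∀ {f g : A → ℕ} → (∀ x → f x ≡ g x) → ∀ xs → ∑ f xs ≡ ∑ g xs
  ∑-cong f≡g xs = cong sum (map-cong f≡g xs)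

  ∑-const : ∀ c (xs : List A) → ∑ (λ _ → c) xs ≡ length xs * c
  ∑-const c []       = refl
  ∑-const c (x ∷ xs) = cong (c +_) (∑-const c xs)

  ∑-+ : ∀ (f g : A → ℕ) xs → ∑ (λ x → f x + g x) xs ≡ ∑ f xs + ∑ g xs
  ∑-+ f g []       = refl
  ∑-+ f g (x ∷ xs) = trans (cong (f x + g x +_) (∑-+ f g xs))
    (solve 4 (λ a b c d → a :+ b :+ (c :+ d) := a :+ c :+ (b :+ d)) refl (f x) (g x) _ _)
    where open +-*-Solver

  ∑-* : ∀ c (f : A → ℕ) xs → ∑ (λ x → c * f x) xs ≡ c * ∑ f xs
  ∑-* c f []       = sym (*-zeroʳ c)
  ∑-* c f (x ∷ xs) = trans (cong (c * f x +_) (∑-* c f xs)) (sym (*-distribˡ-+ c (f x) _))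

  ∑-++ : ∀ (f : A → ℕ) xs ys → ∑ f (xs ++ ys) ≡ ∑ f xs + ∑ f ys
  ∑-++ f xs ys = trans (cong sum (map-++ f xs ys)) (sum-++ (map f xs) (map f ys))

  ∈⇒≤∑ : ∀ (f : A → ℕ) {x xs} → x ∈ xs → f x ≤ ∑ f xs
  ∈⇒≤∑ f (here refl) = m≤m+n _ _
  ∈⇒≤∑ f (there x∈xs) = ≤-trans (∈⇒≤∑ f x∈xs) (m≤n+m _ _)

∑-swap : ∀ {A B : Set} (f : A → B → ℕ) xs ys →
         ∑ (λ x → ∑ (f x) ys) xs ≡ ∑ (λ y → ∑ (λ x → f x y) xs) ys
∑-swap f []       ys = sym (trans (∑-const 0 ys) (*-zeroʳ (length ys)))
∑-swap f (x ∷ xs) ys = trans (cong (∑ (f x) ys +_) (∑-swap f xs ys))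
  (sym (∑-+ (f x) (λ y → ∑ (λ x → f x y) xs) ys))

∑-suc : ∀ {n} (f : Fin (suc n) → ℕ) → ∑ f (allFin (suc n)) ≡ f zero + ∑ (f ∘ suc) (allFin n)
∑-suc {n} f = cong (λ xs → f zero + sum xs)
  (trans (map-tabulate suc f) (sym (map-tabulate id (f ∘ suc))))

-- Counting edges

module _ {A : Set} where

  -- Connectedness of a graph, seen from its vertex labellings.
  Rigid : List (A × A) → Set
  Rigid E = ∀ (ℓ : A → A) → All (λ (u , v) → ℓ u ≡ ℓ v) E → ∀ x y → ℓ x ≡ ℓ y

  agreeing-fixpoints : ∀ {ℓ : A → A} → (∀ x y → ℓ x ≡ ℓ y) →
    ∀ {xs} → Unique xs → All (λ x → ℓ x ≡ x) xs → length xs ≤ 1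
  agreeing-fixpoints const [] _ = z≤n
  agreeing-fixpoints const (_ ∷ []) _ = s≤s z≤n
  agreeing-fixpoints const ((x≢y ∷ _) ∷ _ ∷ _) (ℓx≡x ∷ ℓy≡y ∷ _) =
    contradiction (trans (sym ℓx≡x) (trans (const _ _) ℓy≡y)) x≢y

module _ {A : Set} (_≟_ : DecidableEquality A) where

  _≢?_ : ∀ (x y : A) → _
  x ≢? y = ¬? (x ≟ y)

  length-delete : ∀ w {xs} → Unique xs → length xs ≤ 1 + length (filter (_≢? w) xs)
  length-delete w [] = z≤n
  length-delete w {x ∷ xs} (x∉xs ∷ uniq) with x ≟ w
  ... | yes refl = s≤s (≤-reflexive (cong length
        (sym (filter-all (_≢? w) (All.map (_∘ sym) x∉xs)))))
  ... | no x≢w = s≤s (length-delete w uniq)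

  -- Reading the edges one by one, merging two classes whenever an edge joins
  -- them, loses at most one representative per edge that is not a loop.
  labelling : ∀ (c : A × A → ℕ) → (∀ {u v} → u ≢ v → 1 ≤ c (u , v)) →
    ∀ {vs} → Unique vs → ∀ E →
    ∃ λ (ℓ : A → A) → ∃ λ reps → All (λ (u , v) → ℓ u ≡ ℓ v) E ×
      Unique reps × All (λ r → ℓ r ≡ r) reps × length vs ≤ length reps + ∑ c E
  labelling c c≥1 {vs} uniq [] =
    id , vs , [] , uniq , All.universal (λ _ → refl) vs , m≤m+n _ 0
  labelling c c≥1 uniq ((u , v) ∷ E)
    with ℓ , reps , resp , uniq′ , fix , bound ← labelling c c≥1 uniq E
    with ℓ u ≟ ℓ v
  ... | yes ℓu≡ℓv = ℓ , reps , ℓu≡ℓv ∷ resp , uniq′ , fix ,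
        ≤-trans bound (+-monoʳ-≤ (length reps) (m≤n+m _ _))
  -- The class of `ℓ v` is merged into that of `ℓ u`, so `ℓ v` leaves the representatives.
  ... | no ℓu≢ℓv = merge ∘ ℓ , filter (_≢? ℓ v) reps ,
        trans (merge-other ℓu≢ℓv) (sym merge-self) ∷ All.map (cong merge) resp ,
        Unique.filter⁺ (_≢? ℓ v) uniq′ ,
        All.zipWith (λ (ℓr≡r , r≢ℓv) →
            trans (merge-other (r≢ℓv ∘ trans (sym ℓr≡r))) ℓr≡r)
          (All.filter⁺ (_≢? ℓ v) fix , All.all-filter (_≢? ℓ v) reps) ,
        (begin
          _                                           ≤⟨ bound ⟩
          length reps + ∑ c E                         ≤⟨ +-monoˡ-≤ _ (length-delete (ℓ v) uniq′) ⟩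
          1 + length kept + ∑ c E                     ≡⟨ solve 2
              (λ k s → con 1 :+ k :+ s := k :+ (con 1 :+ s)) refl (length kept) _ ⟩
          length kept + (1 + ∑ c E)                   ≤⟨ +-monoʳ-≤ (length kept)
              (+-monoˡ-≤ _ (c≥1 (ℓu≢ℓv ∘ cong ℓ))) ⟩
          length kept + (c (u , v) + ∑ c E)           ∎)
    where
    open ≤-Reasoning
    open +-*-Solver
    kept = filter (_≢? ℓ v) reps
    merge : A → A
    merge x with x ≟ ℓ v
    ... | yes _ = ℓ u
    ... | no  _ = x
    merge-self : merge (ℓ v) ≡ ℓ u
    merge-self with ℓ v ≟ ℓ v
    ... | yes _ = refl
    ... | no ≢  = contradiction refl ≢
    merge-other : ∀ {x} → x ≢ ℓ v → merge x ≡ x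
    merge-other {x} x≢ with x ≟ ℓ v
    ... | yes x≡ = contradiction x≡ x≢
    ... | no _   = refl

  -- Rigidity makes the final labelling constant, and a constant map fixes at most one
  -- representative. A cost `c` in place of a plain count lets loops count zero.
  rigid⇒many-edges : ∀ (c : A × A → ℕ) → (∀ {u v} → u ≢ v → 1 ≤ c (u , v)) →
    ∀ {vs} → Unique vs → ∀ {E} → Rigid E → length vs ≤ 1 + ∑ c E
  rigid⇒many-edges c c≥1 uniq {E} rigid
    with ℓ , reps , resp , uniq′ , fix , bound ← labelling c c≥1 uniq E =
    ≤-trans bound (+-monoˡ-≤ _ (agreeing-fixpoints (rigid ℓ resp) uniq′ fix))

-- Walks and paths

module _ {V : Set} {E : List (V × V)} where

  walk-invariant : ∀ {A : Set} {f : V → A} → All (λ (u , v) → f u ≡ f v) E →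
    ∀ {u v} → Walk E u v → f u ≡ f v
  walk-invariant resp ε = refl
  walk-invariant resp (inj₁ uv ◅ p) = trans (All.lookup resp uv) (walk-invariant resp p)
  walk-invariant resp (inj₂ vu ◅ p) = trans (sym (All.lookup resp vu)) (walk-invariant resp p)

  walkSum : (V → V → ℕ) → ∀ {u v} → Walk E u v → ℕ
  walkSum w ε = 0
  walkSum w (_◅_ {u} {v} _ p) = w u v + walkSum w p

  -- Weak duality between walk lengths and potentials: the inequalities of the single steps
  -- telescope.
  walk-potential : ∀ {w : V → V → ℕ} {h : V → ℕ} →
    (∀ {u v} → Adjacent E u v → h u ≤ w u v + h v) →
    ∀ {u v} (p : Walk E u v) → h u ≤ walkSum w p + h v
  walk-potential step ε = ≤-refl
  walk-potential {w} step (e ◅ p) =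
    ≤-trans (step e) (≤-trans (+-monoʳ-≤ (w _ _) (walk-potential step p))
      (≤-reflexive (sym (+-assoc (w _ _) (walkSum w p) _))))

  end∈vertices : ∀ {u v} (p : Walk E u v) → v ∈ vertices p
  end∈vertices ε = here refl
  end∈vertices (_ ◅ p) = there (end∈vertices p)

  suffix : ∀ (w : V → V → ℕ) {u v x} (p : Walk E u v) → Unique (vertices p) → x ∈ vertices p →
    Σ (Path E x v) λ q → walkSum w (proj₁ q) ≤ walkSum w p
  suffix w ε uniq (here refl) = (ε , uniq) , ≤-refl
  suffix w (e ◅ p) uniq (here refl) = (e ◅ p , uniq) , ≤-refl
  suffix w (e ◅ p) (_ ∷ uniq) (there x∈p) =
    let q , q≤p = suffix w p uniq x∈p in q , ≤-trans q≤p (m≤n+m _ _)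

  module _ (_≟_ : DecidableEquality V) where

    open DecMembership _≟_ using (_∈?_)

    -- If the start of the walk recurs on the path found for its tail, everything before the
    -- recurrence is cut off. The length is tracked because `totalCost` measures the path that
    -- `connected` supplies.
    shorten : ∀ (w : V → V → ℕ) {u v} (p : Walk E u v) →
      Σ (Path E u v) λ q → walkSum w (proj₁ q) ≤ walkSum w p
    shorten w ε = (ε , [] ∷ []) , ≤-refl
    shorten w {u} (e ◅ p) with (q , uniq) , q≤p ← shorten w p with u ∈? vertices q
    ... | yes u∈q = let r , r≤q = suffix w q uniq u∈q in
                    r , ≤-trans r≤q (≤-trans q≤p (m≤n+m _ _))
    ... | no u∉q = (e ◅ q , All.¬Any⇒All¬ _ u∉q ∷ uniq) , +-monoʳ-≤ (w _ _) q≤p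

-- A cycle would leave the graph connected after the deletion of its closing
-- edge, with too few edges.
few-edges⇒acyclic : ∀ {V : Set} → DecidableEquality V → ∀ {E : List (V × V)} →
  (∀ u v → Walk E u v) → ∀ {vs} → Unique vs → length E < length vs →
  ∀ {u v} (p : Path E u v) → 3 ≤ length (vertices (proj₁ p)) → ¬ Adjacent E v u
few-edges⇒acyclic {V} _≟_ {E} connected {vs} uniq few {u} {v}
  (e₁ ◅ e₂ ◅ p , (u≢x ∷ u∉p) ∷ x∉p ∷ _) 3≤ =
  [ impossible (inj₂ (refl , refl)) , impossible (inj₁ (refl , refl)) ]
  where
  v∈p = end∈vertices p
  x≢v = All.lookup x∉p v∈p
  u≢v = All.lookup u∉p v∈p

  -- With `e` deleted, the rest of the cycle still joins its ends, so `E₁ ++ E₂` is rigid and has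
  -- too few edges for that.
  impossible : ∀ {e : V × V} → SameEdge e (u , v) → ¬ e ∈ E
  impossible {e} same e∈E with E₁ , E₂ , refl ← ∈-∃++ e∈E =
    <⇒≱ few (begin
      length vs                  ≤⟨ bound′ ⟩
      1 + ∑ (λ _ → 1) (E₁ ++ E₂) ≡⟨ cong suc (trans (∑-const 1 (E₁ ++ E₂)) (*-identityʳ _)) ⟩
      1 + length (E₁ ++ E₂)      ≡⟨ cong suc (length-++ E₁) ⟩
      suc (length E₁ + length E₂) ≡⟨ sym (+-suc (length E₁) (length E₂)) ⟩
      length E₁ + suc (length E₂) ≡⟨ sym (length-++ E₁) ⟩
      length (E₁ ++ e ∷ E₂)      ∎)
    where
    open ≤-Reasoning
    rigid : Rigid (E₁ ++ E₂)
    rigid ℓ resp x y = walk-invariant (All.tabulate respE) (connected x y)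
      where
      other : ∀ {f} → f ∈ E₁ ++ e ∷ E₂ → f ≢ e → ℓ (proj₁ f) ≡ ℓ (proj₂ f)
      other f∈ f≢e with ∈-++⁻ E₁ f∈
      ... | inj₁ f∈E₁ = All.lookup resp (∈-++⁺ˡ f∈E₁)
      ... | inj₂ (here f≡e) = contradiction f≡e f≢e
      ... | inj₂ (there f∈E₂) = All.lookup resp (∈-++⁺ʳ E₁ f∈E₂)

      step : ∀ {a b} → Adjacent E a b → ¬ SameEdge (a , b) (u , v) → ℓ a ≡ ℓ b
      step (inj₁ ab) ≁ = other ab λ { refl → ≁ same }
      step (inj₂ ba) ≁ = sym (other ba λ { refl → ≁ (flip-same same) })
        where
        flip-same : ∀ {a b} → SameEdge (a , b) (u , v) → SameEdge (b , a) (u , v)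
        flip-same (inj₁ (p , q)) = inj₂ (q , p)
        flip-same (inj₂ (p , q)) = inj₁ (q , p)

      -- The closing edge has `u` as an end, so a walk that avoids `u` never uses it.
      avoiding : ∀ {a b} (q : Walk E a b) → All (u ≢_) (vertices q) → ℓ a ≡ ℓ b
      avoiding ε _ = refl
      avoiding (e ◅ ε) (u≢a ∷ u≢b ∷ []) = step e λ where
        (inj₁ (a≡u , _)) → u≢a (sym a≡u)
        (inj₂ (_ , b≡u)) → u≢b (sym b≡u)
      avoiding (e ◅ q@(_ ◅ _)) (u≢a ∷ u∉q@(u≢b ∷ _)) = trans
        (step e λ where
          (inj₁ (a≡u , _)) → u≢a (sym a≡u)
          (inj₂ (_ , b≡u)) → u≢b (sym b≡u))
        (avoiding q u∉q)

      ℓu≡ℓv : ℓ u ≡ ℓ v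
      ℓu≡ℓv = trans
        (step e₁ λ where
          (inj₁ (_ , x≡v)) → x≢v x≡v
          (inj₂ (u≡v , _)) → u≢v u≡v)
        (avoiding (e₂ ◅ p) (u≢x ∷ u∉p))

      respE : ∀ {f} → f ∈ E₁ ++ e ∷ E₂ → ℓ (proj₁ f) ≡ ℓ (proj₂ f)
      respE {a , b} f∈ with a ≟ proj₁ e | b ≟ proj₂ e
      ... | no a≢ | _ = other f∈ λ { refl → a≢ refl }
      ... | yes _ | no b≢ = other f∈ λ { refl → b≢ refl }
      ... | yes refl | yes refl = closing same
        where
        closing : ∀ {a b} → SameEdge (a , b) (u , v) → ℓ a ≡ ℓ b
        closing (inj₁ (refl , refl)) = ℓu≡ℓv
        closing (inj₂ (refl , refl)) = sym ℓu≡ℓv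

    bound′ : length vs ≤ 1 + ∑ (λ _ → 1) (E₁ ++ E₂)
    bound′ = rigid⇒many-edges _≟_ (λ _ → 1) (λ _ → s≤s z≤n) uniq rigid
few-edges⇒acyclic _ _ _ _ (ε , _) (s≤s ())
few-edges⇒acyclic _ _ _ _ (_ ◅ ε , _) (s≤s (s≤s ()))

-- The tent function

-- One side of a tent, peak included, adds at most K + (K - 1) + ... + 1. The doubling avoids
-- division.
∑-half-tent : ∀ n K → 2 * ∑ (λ (t : Fin n) → K ∸ toℕ t) (allFin n) ≤ K * suc K
∑-half-tent zero K = z≤n
∑-half-tent (suc n) zero = ≤-reflexive (cong (2 *_)
  (trans (∑-cong (λ t → 0∸n≡0 (toℕ t)) (allFin (suc n)))
    (trans (∑-const 0 (allFin (suc n))) (*-zeroʳ (length (allFin (suc n)))))))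
∑-half-tent (suc n) (suc k) = begin
  2 * ∑ (λ (t : Fin (suc n)) → suc k ∸ toℕ t) (allFin (suc n))
    ≡⟨ cong (2 *_) (∑-suc (λ (t : Fin (suc n)) → suc k ∸ toℕ t)) ⟩
  2 * (suc k + ∑ (λ (t : Fin n) → k ∸ toℕ t) (allFin n))
    ≡⟨ *-distribˡ-+ 2 (suc k) _ ⟩
  2 * suc k + 2 * ∑ (λ (t : Fin n) → k ∸ toℕ t) (allFin n)
    ≤⟨ +-monoʳ-≤ (2 * suc k) (∑-half-tent n k) ⟩
  2 * suc k + k * suc k
    ≡⟨ solve 1 (λ k → con 2 :* (con 1 :+ k) :+ k :* (con 1 :+ k)
                      := (con 1 :+ k) :* (con 2 :+ k)) refl k ⟩
  suc k * suc (suc k) ∎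
  where
  open ≤-Reasoning
  open +-*-Solver

-- The side left of a peak at `s`, without the peak: (K ∸ 1) + ... + (K ∸ s).
leftTent : ℕ → ℕ → ℕ
leftTent K zero    = 0
leftTent K (suc s) = K ∸ suc s + leftTent K s

-- With x = K ∸ s, this is 2 leftTent = K (K - 1) - x (x - 1), freed from subtraction. Beyond s = K
-- both sides stay constant.
leftTent-bound : ∀ K s → 2 * leftTent K s + (K ∸ s) * (K ∸ s) + K ≤ K * K + (K ∸ s)
leftTent-bound K zero = ≤-refl
leftTent-bound K (suc s) rewrite sym (pred[m∸n]≡m∸[1+n] K s) = step (K ∸ s) (leftTent-bound K s)
  where
  open +-*-Solver
  step : ∀ x → 2 * leftTent K s + x * x + K ≤ K * K + x →
         2 * (pred x + leftTent K s) + pred x * pred x + K ≤ K * K + pred x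
  step zero    p = p
  step (suc y) p = +-cancelˡ-≤ 1 _ _ (begin
    1 + (2 * (y + leftTent K s) + y * y + K)
      ≡⟨ solve 3 (λ y h K → con 1 :+ (con 2 :* (y :+ h) :+ y :* y :+ K)
                   := con 2 :* h :+ (con 1 :+ y) :* (con 1 :+ y) :+ K) refl y (leftTent K s) K ⟩
    2 * leftTent K s + suc y * suc y + K   ≤⟨ p ⟩
    K * K + suc y                          ≡⟨ +-suc (K * K) y ⟩
    1 + (K * K + y)                        ∎)
    where open ≤-Reasoning

2*leftTent+K≤K*K : ∀ K s → 2 * leftTent K s + K ≤ K * K
2*leftTent+K≤K*K K s = +-cancelˡ-≤ (K ∸ s) _ _ (begin
  K ∸ s + (2 * leftTent K s + K)                ≤⟨ +-monoˡ-≤ _ (x≤x*x (K ∸ s)) ⟩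
  (K ∸ s) * (K ∸ s) + (2 * leftTent K s + K)    ≡⟨ solve 3
      (λ x h K → x :+ (h :+ K) := h :+ x :+ K) refl ((K ∸ s) * (K ∸ s)) (2 * leftTent K s) K ⟩
  2 * leftTent K s + (K ∸ s) * (K ∸ s) + K      ≤⟨ leftTent-bound K s ⟩
  K * K + (K ∸ s)                               ≡⟨ +-comm (K * K) (K ∸ s) ⟩
  K ∸ s + K * K                                 ∎)
  where
  open ≤-Reasoning
  open +-*-Solver
  x≤x*x : ∀ x → x ≤ x * x
  x≤x*x zero = z≤n
  x≤x*x (suc x) = m≤m*n (suc x) (suc x)

-- Removing the first position moves the peak one step to the left and splits off one term of
-- `leftTent`; once the peak comes first, only the right side remains.
∑-tent-split : ∀ n K (s : Fin n) →
  2 * ∑ (λ t → K ∸ ∣ toℕ s - toℕ t ∣) (allFin n) ≤ 2 * leftTent K (toℕ s) + K * suc K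
∑-tent-split (suc n) K zero = ∑-half-tent (suc n) K
∑-tent-split (suc n) K (suc s) = begin
  2 * ∑ (λ t → K ∸ ∣ suc (toℕ s) - toℕ t ∣) (allFin (suc n))
    ≡⟨ cong (2 *_) (∑-suc (λ (t : Fin (suc n)) → K ∸ ∣ suc (toℕ s) - toℕ t ∣)) ⟩
  2 * (x + rest)                               ≡⟨ *-distribˡ-+ 2 x rest ⟩
  2 * x + 2 * rest                             ≤⟨ +-monoʳ-≤ (2 * x) (∑-tent-split n K s) ⟩
  2 * x + (2 * leftTent K (toℕ s) + K * suc K) ≡⟨ sym (+-assoc (2 * x) _ _) ⟩
  2 * x + 2 * leftTent K (toℕ s) + K * suc K   ≡⟨ cong (_+ K * suc K)
      (sym (*-distribˡ-+ 2 x (leftTent K (toℕ s)))) ⟩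
  2 * (x + leftTent K (toℕ s)) + K * suc K     ∎
  where
  open ≤-Reasoning
  x = K ∸ suc (toℕ s)
  rest = ∑ (λ t → K ∸ ∣ toℕ s - toℕ t ∣) (allFin n)

-- The left side adds at most K (K - 1) / 2, the right side with the peak at most K (K + 1) / 2.
∑-tent : ∀ {n} K (s : Fin n) → ∑ (λ t → K ∸ ∣ toℕ s - toℕ t ∣) (allFin n) ≤ K * K
∑-tent {n} K s = *-cancelˡ-≤ 2 (begin
  2 * ∑ (λ t → K ∸ ∣ toℕ s - toℕ t ∣) (allFin n) ≤⟨ ∑-tent-split n K s ⟩
  2 * leftTent K (toℕ s) + K * suc K             ≡⟨ solve 2
      (λ h K → h :+ K :* (con 1 :+ K) := h :+ K :+ K :* K) refl (2 * leftTent K (toℕ s)) K ⟩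
  2 * leftTent K (toℕ s) + K + K * K             ≤⟨ +-monoˡ-≤ (K * K) (2*leftTent+K≤K*K K (toℕ s)) ⟩
  K * K + K * K                                  ≡⟨ solve 1 (λ x → x :+ x := con 2 :* x) refl
      (K * K) ⟩
  2 * (K * K)                                    ∎)
  where
  open ≤-Reasoning
  open +-*-Solver

-- The metric on the positions of root and sinks

module Positions (k n′ a′ : ℕ) where

  K n a D : ℕ
  K = suc k
  n = suc n′
  a = suc a′
  D = a * suc K

  -- The root lies at `nothing` and sink `t` at `just t`. There are no further points, so every
  -- Steiner vertex shares its position with a terminal.
  Pos : Set
  Pos = Maybe (Fin n)

  gap : Fin n → Fin n → ℕ
  gap i j = ∣ toℕ i - toℕ j ∣

  link isOne isMany : ℕ → ℕ
  link 0             = 0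
  link 1             = a
  link (suc (suc _)) = suc a
  isOne 0             = 0
  isOne 1             = 1
  isOne (suc (suc _)) = 0
  isMany 0             = 0
  isMany 1             = 0
  isMany (suc (suc _)) = 1

  -- `jump`, `short` and `long` are the indicators of root edges, of edges of length a and of edges
  -- of length a + 1; on a loop all three vanish.
  d jump short long : Pos → Pos → ℕ
  d nothing  nothing  = 0
  d nothing  (just _) = D
  d (just _) nothing  = D
  d (just i) (just j) = link (gap i j)
  jump nothing  nothing  = 0
  jump nothing  (just _) = 1
  jump (just _) nothing  = 1
  jump (just _) (just _) = 0
  short (just i) (just j) = isOne (gap i j)
  short _        _        = 0
  long (just i) (just j) = isMany (gap i j)
  long _        _        = 0

  gap≡0⇒≡ : ∀ {i j} → gap i j ≡ 0 → i ≡ j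
  gap≡0⇒≡ = Fin.toℕ-injective ∘ ∣m-n∣≡0⇒m≡n

  d-refl : ∀ p → d p p ≡ 0
  d-refl nothing  = refl
  d-refl (just i) = cong link (∣n-n∣≡0 (toℕ i))

  d-sym : ∀ p q → d p q ≡ d q p
  d-sym nothing  nothing  = refl
  d-sym nothing  (just _) = refl
  d-sym (just _) nothing  = refl
  d-sym (just i) (just j) = cong link (∣-∣-comm (toℕ i) (toℕ j))

  link≤suc-a : ∀ x → link x ≤ suc a
  link≤suc-a 0             = z≤n
  link≤suc-a 1             = n≤1+n a
  link≤suc-a (suc (suc _)) = ≤-refl

  link-mono : ∀ {x y} → x ≤ y → link x ≤ link y
  link-mono {0}           _                 = z≤n
  link-mono {1} {1}       _                 = ≤-refl
  link-mono {1} {suc (suc _)} _             = n≤1+n a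
  link-mono {suc (suc _)} {suc (suc _)} _   = ≤-refl
  link-mono {suc (suc _)} {1} (s≤s ())

  -- Two positive values add up to at least 2 a, and a ≥ 1 makes this at least a + 1, the largest
  -- value of `link`.
  link-subadd : ∀ x y → link (x + y) ≤ link x + link y
  link-subadd zero    y       = ≤-refl
  link-subadd (suc x) zero    = ≤-reflexive
      (trans (cong link (+-identityʳ (suc x))) (sym (+-identityʳ _)))
  link-subadd (suc x) (suc y) = begin
    link (suc x + suc y)  ≤⟨ link≤suc-a (suc x + suc y) ⟩
    1 + a                 ≤⟨ +-monoˡ-≤ a (s≤s z≤n) ⟩
    a + a                 ≤⟨ +-mono-≤ (link-mono {1} {suc x} (s≤s z≤n))
        (link-mono {1} {suc y} (s≤s z≤n)) ⟩
    link (suc x) + link (suc y) ∎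
    where open ≤-Reasoning

  a≤D : a ≤ D
  a≤D = m≤m*n a (suc K)

  suc-a≤D : suc a ≤ D
  suc-a≤D = begin
    1 + a         ≤⟨ +-monoˡ-≤ a (s≤s z≤n) ⟩
    a + a         ≡⟨ solve 1 (λ a → a :+ a := a :* con 2) refl a ⟩
    a * 2         ≤⟨ *-monoʳ-≤ a (s≤s (s≤s z≤n)) ⟩
    a * suc K     ∎
    where
    open ≤-Reasoning
    open +-*-Solver

  -- Among sinks, a monotone subadditive function of the metric `gap` is again subadditive along
  -- triangles. A detour through the root costs 2 D, which exceeds a + 1.
  d-triangle : ∀ p q r → d p r ≤ d p q + d q r
  d-triangle nothing  nothing  r        = ≤-refl
  d-triangle nothing  (just _) nothing  = z≤n
  d-triangle nothing  (just _) (just _) = m≤m+n D _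
  d-triangle (just _) nothing  nothing  = m≤m+n D _
  d-triangle (just i) nothing  (just j) = ≤-trans (link≤suc-a (gap i j))
      (≤-trans suc-a≤D (m≤m+n D D))
  d-triangle (just i) (just j) nothing  = m≤n+m D _
  d-triangle (just i) (just j) (just l) =
    ≤-trans (link-mono (∣-∣-triangle (toℕ i) (toℕ j) (toℕ l))) (link-subadd (gap i j) (gap j l))

  d≡0⇒≡ : ∀ p q → d p q ≡ 0 → p ≡ q
  d≡0⇒≡ nothing  nothing  _ = refl
  d≡0⇒≡ (just i) (just j) eq with gap i j in eq′
  ... | 0 = cong just (gap≡0⇒≡ eq′)
  d≡0⇒≡ (just i) (just j) () | 1
  d≡0⇒≡ (just i) (just j) () | suc (suc _)

  link-split : ∀ x → link x ≡ a * isOne x + suc a * isMany x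
  link-split 0 = sym (cong₂ _+_ (*-zeroʳ a) (*-zeroʳ (suc a)))
  link-split 1 = sym (trans (cong₂ _+_ (*-identityʳ a) (*-zeroʳ (suc a))) (+-identityʳ a))
  link-split (suc (suc _)) = sym (cong₂ _+_ (*-zeroʳ a) (*-identityʳ (suc a)))

  d-split : ∀ p q → d p q ≡ D * jump p q + (a * short p q + suc a * long p q)
  d-split nothing  nothing  = sym (cong₂ _+_ (*-zeroʳ D) (sym (link-split 0)))
  d-split nothing  (just _) = sym
      (trans (cong₂ _+_ (*-identityʳ D) (sym (link-split 0))) (+-identityʳ D))
  d-split (just _) nothing  = sym
      (trans (cong₂ _+_ (*-identityʳ D) (sym (link-split 0))) (+-identityʳ D))
  d-split (just i) (just j) = trans (link-split (gap i j))
      (cong (_+ (a * isOne (gap i j) + suc a * isMany (gap i j))) (sym (*-zeroʳ D)))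

  nonLoop : Pos × Pos → ℕ
  nonLoop (p , q) = jump p q + (short p q + long p q)

  nonLoop≥1 : ∀ {p q} → p ≢ q → 1 ≤ nonLoop (p , q)
  nonLoop≥1 {nothing} {nothing} p≢q = contradiction refl p≢q
  nonLoop≥1 {nothing} {just _}  _   = s≤s z≤n
  nonLoop≥1 {just _}  {nothing} _   = s≤s z≤n
  nonLoop≥1 {just i}  {just j}  p≢q with gap i j in eq
  ... | 0 = contradiction (cong just (gap≡0⇒≡ eq)) p≢q
  ... | 1 = s≤s z≤n
  ... | suc (suc _) = s≤s z≤n

  isMany≡0⇒a*≤link : ∀ x → isMany x ≡ 0 → a * x ≤ link x
  isMany≡0⇒a*≤link 0 _ = ≤-reflexive (*-zeroʳ a)
  isMany≡0⇒a*≤link 1 _ = ≤-reflexive (*-identityʳ a)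

  allPos : List Pos
  allPos = nothing ∷ map just (allFin n)

  allPos-unique : Unique allPos
  allPos-unique = All.map⁺ (All.universal (λ _ ()) (allFin n)) ∷ Unique.map⁺ just-injective
      (Unique.allFin⁺ n)

  -- What an edge may save on the path to `t`, in units of a; only root edges save anything.
  tent : Fin n → Pos × Pos → ℕ
  tent t (nothing , just s)  = K ∸ gap s t
  tent t (just s  , nothing) = K ∸ gap s t
  tent t _                   = 0

  ∑-tent-edge : ∀ e → ∑ (λ t → tent t e) (allFin n) ≤ K * K * uncurry jump e
  ∑-tent-edge (nothing , nothing) = ≤-trans
      (≤-reflexive (trans (∑-const 0 (allFin n)) (*-zeroʳ (length (allFin n))))) z≤n
  ∑-tent-edge (just _ , just _) = ≤-trans
      (≤-reflexive (trans (∑-const 0 (allFin n)) (*-zeroʳ (length (allFin n))))) z≤n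
  ∑-tent-edge (nothing , just s) = ≤-trans (∑-tent K s) (≤-reflexive (sym (*-identityʳ (K * K))))
  ∑-tent-edge (just s , nothing) = ≤-trans (∑-tent K s) (≤-reflexive (sym (*-identityʳ (K * K))))

  -- Length and path bounds for a connected graph on the positions

  module _ (E : List (Pos × Pos)) where

    #jump #short #long len : ℕ
    #jump  = ∑ (uncurry jump) E
    #short = ∑ (uncurry short) E
    #long  = ∑ (uncurry long) E
    len    = ∑ (uncurry d) E

    len-split : len ≡ D * #jump + (a * #short + suc a * #long)
    len-split = begin
      len ≡⟨ ∑-cong (uncurry d-split) E ⟩
      ∑ (λ (p , q) → D * jump p q + (a * short p q + suc a * long p q)) E
        ≡⟨ ∑-+ (λ (p , q) → D * jump p q) (λ (p , q) → a * short p q + suc a * long p q) E ⟩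
      ∑ (λ (p , q) → D * jump p q) E + ∑ (λ (p , q) → a * short p q + suc a * long p q) E
        ≡⟨ cong₂ _+_ (∑-* D (uncurry jump) E)
             (trans (∑-+ (λ (p , q) → a * short p q) (λ (p , q) → suc a * long p q) E)
               (cong₂ _+_ (∑-* a (uncurry short) E) (∑-* (suc a) (uncurry long) E))) ⟩
      D * #jump + (a * #short + suc a * #long) ∎
      where open ≡-Reasoning

    module _ (rigid : Rigid E) where

      -- There are n + 1 positions to connect, and `nonLoop` counts exactly the edges between two
      -- different ones.
      edge-count : n ≤ #jump + (#short + #long)
      edge-count = ≤-trans
        (≤-trans (≤-reflexive (sym (trans (length-map just (allFin n)) (length-tabulate id))))
          (+-cancelˡ-≤ 1 _ _ (rigid⇒many-edges
              (≡-dec Fin._≟_) nonLoop nonLoop≥1 allPos-unique rigid)))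
        (≤-reflexive (trans (∑-+ (uncurry jump) (λ (p , q) → short p q + long p q) E)
          (cong (#jump +_) (∑-+ (uncurry short) (uncurry long) E))))

      -- Without root edges, the labelling `squash` would respect all edges and yet separate the
      -- root from the sinks.
      #jump≥1 : 1 ≤ #jump
      #jump≥1 = n≢0⇒n>0 λ none → contradiction
        (rigid squash (All.tabulate λ {e} e∈E →
          respects e (n≤0⇒n≡0 (≤-trans (∈⇒≤∑ (uncurry jump) e∈E) (≤-reflexive none))))
          nothing (just zero))
        λ ()
        where
        squash : Pos → Pos
        squash nothing  = nothing
        squash (just _) = just zero
        respects : ∀ e → uncurry jump e ≡ 0 → squash (proj₁ e) ≡ squash (proj₂ e)
        respects (nothing , nothing) _ = refl
        respects (just _ , just _)   _ = refl

      -- The term `#long` is what excludes long edges from minimum-length trees.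
      len-bound : D + n′ * a + #long ≤ len
      len-bound = subst (D + n′ * a + #long ≤_) (sym len-split) (bound #jump #jump≥1 edge-count)
        where
        open ≤-Reasoning
        open +-*-Solver
        bound : ∀ j → 1 ≤ j → n ≤ j + (#short + #long) →
                D + n′ * a + #long ≤ D * j + (a * #short + suc a * #long)
        -- One root edge accounts for D. Each of the other edges costs at least a, because a ≤ D,
        -- and a long one costs 1 more.
        bound (suc j) _ (s≤s n′≤) = begin
          D + n′ * a + #long
            ≤⟨ +-monoˡ-≤ #long (+-monoʳ-≤ D (*-monoˡ-≤ a n′≤)) ⟩
          D + (j + (#short + #long)) * a + #long
            ≡⟨ solve 5 (λ D a j s l → D :+ (j :+ (s :+ l)) :* a :+ l
                 := (D :+ a :* j) :+ (a :* s :+ (con 1 :+ a) :* l)) refl D a j #short #long ⟩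
          D + a * j + (a * #short + suc a * #long)
            ≤⟨ +-monoˡ-≤ _ (+-monoʳ-≤ D (*-monoˡ-≤ j a≤D)) ⟩
          D + D * j + (a * #short + suc a * #long)
            ≡⟨ cong (_+ (a * #short + suc a * #long)) (sym (*-suc D j)) ⟩
          D * suc j + (a * #short + suc a * #long) ∎

      -- D = a K + a, so each of the at least n edges pays a, and a root edge pays a K on top.
      len-bound-no-long : #long ≡ 0 → a * K * #jump + n * a ≤ len
      len-bound-no-long none = begin
        a * K * #jump + n * a
          ≤⟨ +-monoʳ-≤ _ (*-monoˡ-≤ a edge-count) ⟩
        a * K * #jump + (#jump + (#short + #long)) * a
          ≡⟨ cong (λ l → a * K * #jump + (#jump + (#short + l)) * a) none ⟩
        a * K * #jump + (#jump + (#short + 0)) * a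
          ≡⟨ solve 4 (λ a K j s → a :* K :* j :+ (j :+ (s :+ con 0)) :* a
               := a :* (con 1 :+ K) :* j :+ (a :* s :+ (con 1 :+ a) :* con 0))
               refl a K #jump #short ⟩
        D * #jump + (a * #short + suc a * 0)
          ≡⟨ cong (λ l → D * #jump + (a * #short + suc a * l)) (sym none) ⟩
        D * #jump + (a * #short + suc a * #long)
          ≡⟨ sym len-split ⟩
        len ∎
        where
        open ≤-Reasoning
        open +-*-Solver

    -- A lower bound for the gap between t and the nearest end of a root edge,
    -- cut off at K.
    reserve : Fin n → ℕ
    reserve t = K ∸ ∑ (tent t) E

    -- Truncation only helps: K ≤ `reserve t` plus the tents at `t`. Summed over `t` and exchanged
    -- with the sum over edges, the tents of one root edge total at most K².
    ∑-reserve : n * K ≤ ∑ reserve (allFin n) + K * K * #jump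
    ∑-reserve = begin
      n * K
        ≡⟨ cong (_* K) (sym (length-tabulate {n = n} id)) ⟩
      length (allFin n) * K
        ≡⟨ sym (∑-const K (allFin n)) ⟩
      ∑ (λ _ → K) (allFin n)
        ≤⟨ ∑-mono (λ t → ≤-trans (m≤n+m∸n K (∑ (tent t) E))
            (≤-reflexive (+-comm (∑ (tent t) E) _))) (allFin n) ⟩
      ∑ (λ t → reserve t + ∑ (tent t) E) (allFin n)
        ≡⟨ ∑-+ reserve (λ t → ∑ (tent t) E) (allFin n) ⟩
      ∑ reserve (allFin n) + ∑ (λ t → ∑ (tent t) E) (allFin n)
        ≡⟨ cong (∑ reserve (allFin n) +_) (∑-swap tent (allFin n) E) ⟩
      ∑ reserve (allFin n) + ∑ (λ e → ∑ (λ t → tent t e) (allFin n)) E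
        ≤⟨ +-monoʳ-≤ _ (∑-mono ∑-tent-edge E) ⟩
      ∑ reserve (allFin n) + ∑ (λ e → K * K * uncurry jump e) E
        ≡⟨ cong (∑ reserve (allFin n) +_) (∑-* (K * K) (uncurry jump) E) ⟩
      ∑ reserve (allFin n) + K * K * #jump ∎
      where open ≤-Reasoning

    -- A potential for walks towards t: the last root edge is followed by
    -- short edges only.
    potential : Fin n → Pos → ℕ
    potential t nothing  = D + a * reserve t
    potential t (just i) = a * (gap i t ⊓ reserve t)

    potential-end : ∀ t → potential t (just t) ≡ 0
    potential-end t = trans (cong (λ x → a * (x ⊓ reserve t)) (∣n-n∣≡0 (toℕ t))) (*-zeroʳ a)

    -- The tent K ∸ `gap s t` of this root edge is one summand of what `reserve` subtracts from K.
    reserve≤gap : ∀ t s → (nothing , just s) ∈ E ⊎ (just s , nothing) ∈ E → reserve t ≤ gap s t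
    reserve≤gap t s e∈E = m≤n+o⇒m∸n≤o K (∑ (tent t) E)
      (≤-trans (m≤n+m∸n K (gap s t))
        (≤-trans (≤-reflexive (+-comm (gap s t) _)) (+-monoˡ-≤ (gap s t) (near e∈E))))
      where
      near : (nothing , just s) ∈ E ⊎ (just s , nothing) ∈ E → K ∸ gap s t ≤ ∑ (tent t) E
      near = [ ∈⇒≤∑ (tent t) , ∈⇒≤∑ (tent t) ]

    -- Leaving the root pays D and reaches a sink whose gap is at least the reserve, so the minimum
    -- there is the reserve. Returning is harmless because the minimum never exceeds the reserve.
    -- Between sinks, each unit of gap is paid with a.
    potential-step : #long ≡ 0 → ∀ t p q → Adjacent E p q → potential t p ≤ d p q + potential t q
    potential-step none t nothing  nothing  _ = ≤-refl
    potential-step none t nothing  (just s) e =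
      +-monoʳ-≤ D (*-monoʳ-≤ a (⊓-glb (reserve≤gap t s e) ≤-refl))
    potential-step none t (just s) nothing  _ =
      ≤-trans (*-monoʳ-≤ a (m⊓n≤n (gap s t) _)) (≤-trans (m≤n+m _ D) (m≤n+m _ D))
    potential-step none t (just i) (just j) e = begin
      a * (gap i t ⊓ reserve t)
        ≤⟨ *-monoʳ-≤ a (⊓-mono-≤ (∣-∣-triangle (toℕ i) (toℕ j) (toℕ t))
            (m≤n+m (reserve t) (gap i j))) ⟩
      a * ((gap i j + gap j t) ⊓ (gap i j + reserve t))
        ≡⟨ cong (a *_) (sym (+-distribˡ-⊓ (gap i j) _ _)) ⟩
      a * (gap i j + (gap j t ⊓ reserve t))
        ≡⟨ *-distribˡ-+ a (gap i j) _ ⟩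
      a * gap i j + a * (gap j t ⊓ reserve t)
        ≤⟨ +-monoˡ-≤ _ (isMany≡0⇒a*≤link (gap i j)
            (n≤0⇒n≡0 (≤-trans (long≤ e) (≤-reflexive none)))) ⟩
      link (gap i j) + a * (gap j t ⊓ reserve t) ∎
      where
      open ≤-Reasoning
      long≤ : Adjacent E (just i) (just j) → isMany (gap i j) ≤ #long
      long≤ (inj₁ ij) = ∈⇒≤∑ (uncurry long) ij
      long≤ (inj₂ ji) = ≤-trans (≤-reflexive (cong isMany (∣-∣-comm (toℕ i) (toℕ j))))
          (∈⇒≤∑ (uncurry long) ji)

    -- The root edges bought for K a each pay for themselves: the two sides
    -- of this bound no longer mention their number.
    cost-bound : Rigid E → #long ≡ 0 → ∀ (W : Fin n → ℕ) →
      (∀ t → potential t nothing ≤ W t) →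
      n * a * (3 * K + 1) ≤ K * len + ∑ W (allFin n)
    cost-bound rigid none W pot≤W = +-cancelˡ-≤ (a * (K * K * #jump)) _ _ (begin
      a * (K * K * #jump) + n * a * (3 * K + 1)
        ≡⟨ solve 4 (λ a K j n → a :* (K :* K :* j) :+ n :* a :* (con 3 :* K :+ con 1)
             := K :* (a :* K :* j :+ n :* a) :+ (n :* (a :* (con 1 :+ K)) :+ a :* (n :* K)))
             refl a K #jump n ⟩
      K * (a * K * #jump + n * a) + (n * D + a * (n * K))
        ≤⟨ +-mono-≤ (*-monoʳ-≤ K (len-bound-no-long rigid none))
            (+-monoʳ-≤ (n * D) (*-monoʳ-≤ a ∑-reserve)) ⟩
      K * len + (n * D + a * (∑ reserve (allFin n) + K * K * #jump))
        ≡⟨ solve 5 (λ x y a r z → x :+ (y :+ a :* (r :+ z)) := a :* z :+ (x :+ (y :+ a :* r)))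
             refl (K * len) (n * D) a (∑ reserve (allFin n)) (K * K * #jump) ⟩
      a * (K * K * #jump) + (K * len + (n * D + a * ∑ reserve (allFin n)))
        ≡⟨ cong (λ x → a * (K * K * #jump) + (K * len + x)) (sym
             (trans (∑-+ (λ _ → D) (λ t → a * reserve t) (allFin n))
               (cong₂ _+_ (trans (∑-const D (allFin n)) (cong (_* D) (length-tabulate {n = n} id)))
                 (∑-* a reserve (allFin n))))) ⟩
      a * (K * K * #jump) + (K * len + ∑ (λ t → D + a * reserve t) (allFin n))
        ≤⟨ +-monoʳ-≤ (a * (K * K * #jump)) (+-monoʳ-≤ (K * len) (∑-mono pot≤W (allFin n))) ⟩
      a * (K * K * #jump) + (K * len + ∑ W (allFin n)) ∎)
      where
      open ≤-Reasoning
      open +-*-Solver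

-- Naturals among the rationals and the reals

-- Opaque, because unfolding rational arithmetic on open terms is prohibitively slow.

opaque

  ι : ℕ → ℚ
  ι m = fromℤ (ℤ.+ m)

  ι-+ : ∀ m n → ι (m + n) ≡ ι m ℚ.+ ι n
  ι-+ m n = ℚ.toℚᵘ-injective (ℚᵘ.≃-sym (ℚᵘ.≃-trans (ℚ.toℚᵘ-homo-+ (ι m) (ι n))
    (ℚᵘ.*≡* (cong (ℤ._* ℤ.+ 1) (cong₂ ℤ._+_ (ℤ.*-identityʳ (ℤ.+ m)) (ℤ.*-identityʳ (ℤ.+ n)))))))

  ι-* : ∀ m n → ι (m * n) ≡ ι m ℚ.* ι n
  ι-* m n = ℚ.toℚᵘ-injective (ℚᵘ.≃-sym (ℚᵘ.≃-trans (ℚ.toℚᵘ-homo-* (ι m) (ι n))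
    (ℚᵘ.*≡* (cong (ℤ._* ℤ.+ 1) (sym (ℤ.pos-* m n))))))

  ι-mono : ∀ {m n} → m ≤ n → ι m ℚ.≤ ι n
  ι-mono m≤n = ℚ.*≤* (ℤ.*-monoʳ-≤-nonNeg (ℤ.+ 1) (ℤ.+≤+ m≤n))

  ι-cancel : ∀ {m n} → ι m ℚ.≤ ι n → m ≤ n
  ι-cancel (ℚ.*≤* p) = ℤ.drop‿+≤+ (ℤ.*-cancelʳ-≤-pos _ _ (ℤ.+ 1) p)

  ι-nonNeg : ∀ n → ℚ.NonNegative (ι n)
  ι-nonNeg n = _

  ι-pos : ∀ n → ℚ.Positive (ι (suc n))
  ι-pos n = _

  ι-0 : ι 0 ≡ 0ℚ
  ι-0 = refl

  ι-1 : ι 1 ≡ 1ℚ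
  ι-1 = refl

  archimedean : ∀ e → .{{ℚ.Positive e}} → ∃ λ q → 1ℚ ℚ.≤ e ℚ.* ι (suc q)
  -- `e` has denominator `suc d` and numerator at least 1, so multiplying by `suc d` suffices.
  archimedean e@(mkℚ ℤ.+[1+ m ] d _) = d , ℚ.toℚᵘ-cancel-≤
    (ℚᵘ.≤-trans (ℚᵘ.*≤* bound) (ℚᵘ.≤-reflexive (ℚᵘ.≃-sym (ℚ.toℚᵘ-homo-* e (ι (suc d))))))
    where
    bound : ℤ.+ 1 ℤ.* (ℤ.+ (suc d * 1)) ℤ.≤ (ℤ.+ suc m ℤ.* ℤ.+ suc d) ℤ.* ℤ.+ 1
    bound = subst (λ x → ℤ.+ 1 ℤ.* ℤ.+ x ℤ.≤ (ℤ.+ suc m ℤ.* ℤ.+ suc d) ℤ.* ℤ.+ 1)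
        (sym (*-identityʳ (suc d)))
      (subst (ℤ._≤ (ℤ.+ suc m ℤ.* ℤ.+ suc d) ℤ.* ℤ.+ 1) (sym (ℤ.*-identityˡ (ℤ.+ suc d)))
        (subst (ℤ.+ suc d ℤ.≤_) (sym (ℤ.*-identityʳ _))
          (ℤ.+≤+ (m≤m+n (suc d) _))))

infix 4 _≐_

-- Equality of every entry, and not only in the limit, turns inequalities of real costs into
-- inequalities of naturals.
_≐_ : ℝ → ℕ → Set
x ≐ m = ∀ i → seq x i ≡ ι m

≐⇒≤ℝ : ∀ {x y m n} → x ≐ m → y ≐ n → m ≤ n → x ≤ℝ y
≐⇒≤ℝ {x} {y} {m} {n} x≐m y≐n m≤n e e>0 = 0 , λ i _ → begin
  seq x i        ≡⟨ x≐m i ⟩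
  ι m            ≤⟨ ι-mono m≤n ⟩
  ι n            ≡⟨ sym (ℚ.+-identityʳ (ι n)) ⟩
  ι n ℚ.+ 0ℚ     ≤⟨ ℚ.+-monoʳ-≤ (ι n) (ℚ.<⇒≤ e>0) ⟩
  ι n ℚ.+ e      ≡⟨ cong (ℚ._+ e) (sym (y≐n i)) ⟩
  seq y i ℚ.+ e  ∎
  where open ℚ.≤-Reasoning

≤ℝ⇒≤ : ∀ {x y m n} → x ≐ m → y ≐ n → x ≤ℝ y → m ≤ n
-- Distinct naturals differ by at least 1, so the tolerance ½ decides their order.
≤ℝ⇒≤ {x} {y} {m} {n} x≐m y≐n x≤y with x≤y ½ (ℚ.positive⁻¹ ½)
... | N , p = ≮⇒≥ λ n<m → contradiction
  (begin-strict
    ι n ℚ.+ ½     <⟨ ℚ.+-monoʳ-< (ι n) ½<1 ⟩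
    ι n ℚ.+ 1ℚ    ≡⟨ cong (ι n ℚ.+_) (sym ι-1) ⟩
    ι n ℚ.+ ι 1   ≡⟨ sym (ι-+ n 1) ⟩
    ι (n + 1)     ≤⟨ ι-mono (≤-trans (≤-reflexive (+-comm n 1)) n<m) ⟩
    ι m           ≡⟨ sym (x≐m N) ⟩
    seq x N       ≤⟨ p N ≤-refl ⟩
    seq y N ℚ.+ ½ ≡⟨ cong (ℚ._+ ½) (y≐n N) ⟩
    ι n ℚ.+ ½     ∎)
  (ℚ.<-irrefl refl)
  where
  open ℚ.≤-Reasoning
  ½<1 : ½ ℚ.< 1ℚ
  ½<1 = ℚ.*<* (ℤ.+<+ (s≤s (s≤s z≤n)))

0≐0 : 0ℝ ≐ 0
0≐0 _ = sym ι-0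

≐-+ : ∀ {x y m n} → x ≐ m → y ≐ n → x +ℝ y ≐ m + n
≐-+ {m = m} {n} x≐m y≐n i = trans (cong₂ ℚ._+_ (x≐m i) (y≐n i)) (sym (ι-+ m n))

≐-sum : ∀ {A : Set} {f : A → ℝ} {g : A → ℕ} → (∀ x → f x ≐ g x) → ∀ xs → sumℝ (map f xs) ≐ ∑ g xs
≐-sum f≐g []       i = sym ι-0
≐-sum {f = f} f≐g (x ∷ xs) = ≐-+ {f x} {sumℝ (map f xs)} (f≐g x) (≐-sum f≐g xs)

-- Decidable equality and an order on tree vertices

module _ {n m : ℕ} where

  sink-injective : ∀ {i j} → sink {n} {m} i ≡ sink j → i ≡ j
  sink-injective refl = refl

  _≟ᵛ_ : DecidableEquality (Vertex n m)
  root      ≟ᵛ root      = yes refl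
  root      ≟ᵛ sink _    = no λ ()
  root      ≟ᵛ steiner _ = no λ ()
  sink _    ≟ᵛ root      = no λ ()
  sink i    ≟ᵛ sink j    = map′ (cong sink) sink-injective (i Fin.≟ j)
  sink _    ≟ᵛ steiner _ = no λ ()
  steiner _ ≟ᵛ root      = no λ ()
  steiner _ ≟ᵛ sink _    = no λ ()
  steiner i ≟ᵛ steiner j = map′ (cong steiner) (λ { refl → refl }) (i Fin.≟ j)

  -- The root comes first and the sinks follow in their order; the value at Steiner vertices is a
  -- default.
  rank : Vertex n m → ℕ
  rank root        = 0
  rank (sink i)    = suc (toℕ i)
  rank (steiner _) = 0

-- Trees without Steiner vertices in which each sink is joined to an earlier vertex

module ParentTree {n} (parent : Fin n → Vertex n 0)
    (earlier : ∀ i → rank (parent i) < rank {n} {0} (sink i)) where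

  edgesᵖ : List (Vertex n 0 × Vertex n 0)
  edgesᵖ = tabulate λ i → parent i , sink i

  parentEdge : ∀ i → Adjacent edgesᵖ (parent i) (sink i)
  parentEdge i = inj₁ (∈-tabulate⁺ i)

  module _ (w : Vertex n 0 → Vertex n 0 → ℕ) (reach : ∀ i → Walk edgesᵖ root (sink i)) where

    private
      reach⁺ : ∀ v → Walk edgesᵖ root v
      reach⁺ root     = ε
      reach⁺ (sink i) = reach i

      walk : ∀ u v → Walk edgesᵖ u v
      walk u v = reverse swap (reach⁺ u) ◅◅ reach⁺ v

      vertexList : List (Vertex n 0)
      vertexList = root ∷ tabulate sink

      vertexList-unique : Unique vertexList
      vertexList-unique = All.tabulate⁺ (λ _ ()) ∷ Unique.tabulate⁺ sink-injective

    -- The order excludes loops and reversed copies of edges; n edges against n + 1 vertices exclude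
    -- cycles.
    isTreeᵖ : IsTree edgesᵖ
    isTreeᵖ = record
      { loopless   = All.tabulate⁺ λ i eq → <-irrefl (cong rank eq) (earlier i)
      ; noParallel = AllPairs.tabulate⁺ λ {i} {j} i≢j → λ where
          (inj₁ (_ , eq)) → i≢j (sink-injective eq)
          (inj₂ (pi≡j , i≡pj)) → <-asym
            (subst (_< suc (toℕ i)) (cong rank pi≡j) (earlier i))
            (subst (_< suc (toℕ j)) (cong rank (sym i≡pj)) (earlier j))
      ; connected  = λ u v → proj₁ (shorten _≟ᵛ_ w (walk u v))
      ; acyclic    = few-edges⇒acyclic _≟ᵛ_ walk vertexList-unique
          (s≤s (≤-reflexive (trans (length-tabulate _) (sym (length-tabulate {n = n} sink)))))
      }

    -- The paths of the tree are built by shortening, so an explicit walk bounds the length of the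
    -- path that the total cost refers to.
    rootPath≤reach : ∀ i →
      walkSum w (proj₁ (IsTree.connected isTreeᵖ root (sink i))) ≤ walkSum w (reach i)
    rootPath≤reach i = proj₂ (shorten _≟ᵛ_ w (reach i))

walkSum-≡ : ∀ {V : Set} {E : List (V × V)} {w w′ : V → V → ℕ} → (∀ u v → w u v ≡ w′ u v) →
  ∀ {u v} (p : Walk E u v) → walkSum w p ≡ walkSum w′ p
walkSum-≡ w≡ ε = refl
walkSum-≡ w≡ (_ ◅ p) = cong₂ _+_ (w≡ _ _) (walkSum-≡ w≡ p)

-- The instance, its minimum-length trees and its optimum

module LowerBound (k n′ a′ : ℕ) where
  open Positions k n′ a′

  opaque

    ω : ℚ
    ω = (1/ ι K) {{ℚ.pos⇒nonZero (ι K) {{ι-pos k}}}}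

    ω>0 : 0ℚ ℚ.< ω
    ω>0 = ℚ.positive⁻¹ ω {{ℚ.1/pos⇒pos (ι K) {{ι-pos k}}}}

    ω-cancel : ∀ m → ω ℚ.* ι (K * m) ≡ ι m
    ω-cancel m = begin
      ω ℚ.* ι (K * m)       ≡⟨ cong (ω ℚ.*_) (ι-* K m) ⟩
      ω ℚ.* (ι K ℚ.* ι m)   ≡⟨ sym (ℚ.*-assoc ω (ι K) (ι m)) ⟩
      ω ℚ.* ι K ℚ.* ι m     ≡⟨ cong (ℚ._* ι m)
          (ℚ.*-inverseˡ (ι K) {{ℚ.pos⇒nonZero (ι K) {{ι-pos k}}}}) ⟩
      1ℚ ℚ.* ι m            ≡⟨ ℚ.*-identityˡ (ι m) ⟩
      ι m                   ∎
      where open ≡-Reasoning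

  weighted : ∀ x y {m} → (∀ i → seq x i ≡ ω) → y ≐ K * m → x *ℝ y ≐ m
  weighted x y {m} x≡ω y≐ i = trans (cong₂ ℚ._*_ (x≡ω i) (y≐ i)) (ω-cancel m)

  distance : Pos → Pos → ℝ
  distance p q = fromℚ (ι (K * d p q))

  distance≐ : ∀ p q → distance p q ≐ K * d p q
  distance≐ p q _ = refl

  distance-≤ : ∀ {p q p′ q′} → d p q ≤ d p′ q′ → distance p q ≤ℝ distance p′ q′
  distance-≤ {p} {q} {p′} {q′} le =
    ≐⇒≤ℝ {distance p q} {distance p′ q′} (distance≐ p q) (distance≐ p′ q′) (*-monoʳ-≤ K le)

  metricSpace : MetricSpace
  metricSpace = record
    { Carrier  = Pos
    ; _≈_      = _≡_
    ; dist     = distance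
    ; isMetric = record
      { isSemiMetric = record
        { isQuasiSemiMetric = record
          { isPreMetric = record
            { isProtoMetric = record
              { isPartialOrder  = ≤ℝ-isPartialOrder
              ; ≈-isEquivalence = isEquivalence
              ; cong            = λ { {p} {_} {q} refl refl → distance-≤ {p} {q} {p} {q} ≤-refl ,
                  distance-≤ {p} {q} {p} {q} ≤-refl }
              ; nonNegative     = λ {p} {q} → ≐⇒≤ℝ {0ℝ} {distance p q} {0} 0≐0 (distance≐ p q) z≤n
              }
            ; ≈⇒0 = λ { {p} refl → distance-refl p }
            }
          ; 0⇒≈ = λ {p} {q} (pq≤0 , _) → d≡0⇒≡ p q
              (K*m≤0⇒m≡0 (≤ℝ⇒≤ {distance p q} {0ℝ} {n = 0} (distance≐ p q) 0≐0 pq≤0))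
          }
        ; sym = λ p q → distance-≤ {p} {q} {q} {p} (≤-reflexive (d-sym p q)) ,
            distance-≤ {q} {p} {p} {q} (≤-reflexive (d-sym q p))
        }
      ; triangle = λ p q r → ≐⇒≤ℝ {distance p r} {distance p q +ℝ distance q r} (distance≐ p r)
          (≐-+ {distance p q} {distance q r} (distance≐ p q) (distance≐ q r))
          (≤-trans (*-monoʳ-≤ K (d-triangle p q r)) (≤-reflexive (*-distribˡ-+ K (d p q) (d q r))))
      }
    }
    where
    K*m≤0⇒m≡0 : ∀ {m} → K * m ≤ 0 → m ≡ 0
    K*m≤0⇒m≡0 {m} le = n≤0⇒n≡0 (≤-trans (m≤n*m m K) le)

    distance-refl : ∀ p → distance p p ≈ℝ 0ℝ
    distance-refl p =
      ≐⇒≤ℝ {distance p p} {0ℝ} {n = 0} (distance≐ p p) 0≐0 (≤-reflexive K*d≡0) ,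
      ≐⇒≤ℝ {0ℝ} {distance p p} {0} 0≐0 (distance≐ p p) z≤n
      where
      K*d≡0 : K * d p p ≡ 0
      K*d≡0 = trans (cong (K *_) (d-refl p)) (*-zeroʳ K)

  I : Instance
  I = record
    { space    = metricSpace
    ; #sinks   = n
    ; rootPos  = nothing
    ; sinkPos  = just
    ; weight   = λ _ → fromℚ ω
    ; weight≥0 = λ _ e e>0 → 0 , λ _ _ → ℚ.<⇒≤ (ℚ.+-mono-< ω>0 e>0)
    }

  module _ (B : SteinerTree I) where
    open SteinerTree B

    place : Vertex n #steiner × Vertex n #steiner → Pos × Pos
    place (u , v) = pos u , pos v

    -- The tree with vertices at the same position identified. This may create loops, parallel edges
    -- and cycles, so the bounds on it rest on connectedness alone.
    placed : List (Pos × Pos)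
    placed = map place edges

    pathLength : Fin n → ℕ
    pathLength t = walkSum (λ u v → d (pos u) (pos v)) (proj₁ (rootPath t))

    -- The scaling factor K stays on the tree length, while in the delays it cancels against the
    -- weight 1/K.
    scaledCost : ℕ
    scaledCost = K * len placed + ∑ pathLength (allFin n)

    treeLength≐ : treeLength ≐ K * len placed
    treeLength≐ i = trans (≐-sum {f = λ (u , v) → cost u v}
        (λ (u , v) → distance≐ (pos u) (pos v)) edges i)
      (cong ι (trans (∑-* K (λ (u , v) → d (pos u) (pos v)) edges)
          (cong (K *_) (cong sum (map-∘ edges)))))

    walkLength≐ : ∀ {u v} (p : Walk edges u v) →
      walkLength p ≐ K * walkSum (λ u v → d (pos u) (pos v)) p
    walkLength≐ ε i = trans (sym ι-0) (cong ι (sym (*-zeroʳ K)))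
    walkLength≐ (_◅_ {u} {v} _ p) i = trans
      (≐-+ {cost u v} {walkLength p} (distance≐ (pos u) (pos v)) (walkLength≐ p) i)
      (cong ι (sym (*-distribˡ-+ K (d (pos u) (pos v)) _)))

    totalCost≐ : totalCost ≐ scaledCost
    totalCost≐ = ≐-+ {treeLength} {sumℝ (map delay (allFin n))} treeLength≐
      (≐-sum {f = delay} (λ t → weighted (weight t) (walkLength (proj₁ (rootPath t))) (λ _ → refl)
        (walkLength≐ (proj₁ (rootPath t)))) (allFin n))
      where
      open Instance I using (weight)
      delay : Fin n → ℝ
      delay t = weight t *ℝ walkLength (proj₁ (rootPath t))

    -- Every point of the space is the position of a terminal, and its root path carries the label
    -- of `nothing` to it.
    placed-rigid : Rigid placed
    placed-rigid ℓ resp p q = trans (sym (reaches p)) (reaches q)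
      where
      reaches : ∀ p → ℓ nothing ≡ ℓ p
      reaches nothing  = refl
      reaches (just t) = walk-invariant {f = ℓ ∘ pos} (All.map⁻ resp) (proj₁ (rootPath t))

    adjacent-placed : ∀ {u v} → Adjacent edges u v → Adjacent placed (pos u) (pos v)
    adjacent-placed (inj₁ uv) = inj₁ (∈-map⁺ place uv)
    adjacent-placed (inj₂ vu) = inj₂ (∈-map⁺ place vu)

    -- Along the path to `t` the potential falls to 0, so its value at the root bounds the length of
    -- that path from below.
    scaledCost-bound : #long placed ≡ 0 → n * a * (3 * K + 1) ≤ scaledCost
    scaledCost-bound none = cost-bound placed placed-rigid none pathLength λ t → begin
      potential placed t nothing
        ≤⟨ walk-potential {h = potential placed t ∘ pos}
             (λ {u} {v} uv → potential-step placed none t (pos u) (pos v) (adjacent-placed uv))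
             (proj₁ (rootPath t)) ⟩
      pathLength t + potential placed t (just t)
        ≡⟨ trans (cong (pathLength t +_) (potential-end placed t)) (+-identityʳ _) ⟩
      pathLength t ∎
      where open ≤-Reasoning

  pos⁰ : Vertex n 0 → Pos
  pos⁰ root     = nothing
  pos⁰ (sink t) = just t

  w⁰ : Vertex n 0 → Vertex n 0 → ℕ
  w⁰ u v = d (pos⁰ u) (pos⁰ v)

  module _ (parent : Fin n → Vertex n 0)
      (earlier : ∀ i → rank (parent i) < rank {n} {0} (sink i)) where
    open ParentTree parent earlier

    module _ (reach : ∀ i → Walk edgesᵖ root (sink i)) where

      parentTree : SteinerTree I
      parentTree = record
        { #steiner   = 0
        ; steinerPos = λ ()
        ; edges      = edgesᵖ
        ; isTree     = isTreeᵖ w⁰ reach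
        }

      private
        pos≡pos⁰ : ∀ v → SteinerTree.pos parentTree v ≡ pos⁰ v
        pos≡pos⁰ root     = refl
        pos≡pos⁰ (sink _) = refl

      parentTree-len : ∀ {b} → parent zero ≡ root → (∀ i → w⁰ (parent (suc i)) (sink (suc i)) ≤ b) →
        len (placed parentTree) ≤ D + n′ * b
      parentTree-len {b} first rest = begin
        len (placed parentTree)
          ≡⟨ cong sum (sym (map-∘ edgesᵖ)) ⟩
        ∑ (λ (u , v) → d (SteinerTree.pos parentTree u) (SteinerTree.pos parentTree v)) edgesᵖ
          ≡⟨ ∑-cong (λ (u , v) → cong₂ d (pos≡pos⁰ u) (pos≡pos⁰ v)) edgesᵖ ⟩
        ∑ (uncurry w⁰) edgesᵖ
          ≡⟨ cong sum (trans (map-tabulate (λ i → parent i , sink i) (uncurry w⁰))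
              (sym (map-tabulate id step))) ⟩
        ∑ step (allFin n)
          ≡⟨ ∑-suc step ⟩
        step zero + ∑ (step ∘ suc) (allFin n′)
          ≤⟨ +-mono-≤ (≤-reflexive (cong (λ v → w⁰ v (sink zero)) first))
              (∑-mono rest (allFin n′)) ⟩
        D + ∑ (λ _ → b) (allFin n′)
          ≡⟨ cong (D +_) (trans (∑-const b (allFin n′))
              (cong (_* b) (length-tabulate {n = n′} id))) ⟩
        D + n′ * b ∎
        where
        open ≤-Reasoning
        step : Fin n → ℕ
        step i = w⁰ (parent i) (sink i)

      parentTree-path : ∀ t → pathLength parentTree t ≤ walkSum w⁰ (reach t)
      parentTree-path t = ≤-trans
        (≤-reflexive (walkSum-≡ (λ u v → cong₂ d (pos≡pos⁰ u) (pos≡pos⁰ v))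
            (proj₁ (SteinerTree.rootPath parentTree t))))
        (rootPath≤reach w⁰ reach t)

  spineParent : Fin n → Vertex n 0
  spineParent zero    = root
  spineParent (suc i) = sink (inject₁ i)

  spine-earlier : ∀ i → rank (spineParent i) < rank {n} {0} (sink i)
  spine-earlier zero    = s≤s z≤n
  spine-earlier (suc i) = s≤s (s≤s (≤-reflexive (Fin.toℕ-inject₁ i)))

  -- The minimum-length tree handed to the algorithm; its length attains `len-bound` without long
  -- edges.
  spine : SteinerTree I
  spine = parentTree spineParent spine-earlier
    (<-weakInduction _ (parentEdge zero ◅ ε) (λ i p → p ◅◅ parentEdge (suc i) ◅ ε))
    where open ParentTree spineParent spine-earlier

  len-spine : len (placed spine) ≤ D + n′ * a
  len-spine = parentTree-len spineParent spine-earlier _ refl λ i →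
    ≤-reflexive (cong link (consecutive i))
    where
    ∣m-1+m∣ : ∀ m → ∣ m - suc m ∣ ≡ 1
    ∣m-1+m∣ zero    = refl
    ∣m-1+m∣ (suc m) = ∣m-1+m∣ m
    consecutive : ∀ i → ∣ toℕ (inject₁ i) - suc (toℕ i) ∣ ≡ 1
    consecutive i rewrite Fin.toℕ-inject₁ i = ∣m-1+m∣ (toℕ i)

  spine-minimum : IsMinimumLength I spine
  spine-minimum B = ≐⇒≤ℝ {SteinerTree.treeLength spine} {SteinerTree.treeLength B}
      (treeLength≐ spine) (treeLength≐ B)
    (*-monoʳ-≤ K (≤-trans len-spine
        (≤-trans (m≤m+n _ (#long (placed B))) (len-bound (placed B) (placed-rigid B)))))

  -- `len-bound` exceeds the length of `spine` by the number of long edges, so a tree as short as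
  -- `spine` has none.
  minimum⇒no-long : ∀ {A} → IsMinimumLength I A → #long (placed A) ≡ 0
  minimum⇒no-long {A} min = n≤0⇒n≡0 (+-cancelˡ-≤ (D + n′ * a) _ _ (begin
    D + n′ * a + #long (placed A) ≤⟨ len-bound (placed A) (placed-rigid A) ⟩
    len (placed A)                ≤⟨ *-cancelˡ-≤ K
        (≤ℝ⇒≤ {SteinerTree.treeLength A} {SteinerTree.treeLength spine}
          (treeLength≐ A) (treeLength≐ spine) (min spine)) ⟩
    len (placed spine)            ≤⟨ len-spine ⟩
    D + n′ * a                    ≡⟨ sym (+-identityʳ _) ⟩
    D + n′ * a + 0                ∎))
    where open ≤-Reasoning

  -- Deleting edges creates no long ones, and a reconnecting edge is not long because it starts at
  -- the root.
  output-no-long : ∀ (S : SubdivideAndReconnect I) →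
    #long (placed (SubdivideAndReconnect.output S)) ≡ 0
  output-no-long S = trans (cong sum (sym (map-∘ outputEdges)))
    (trans (∑-cong (λ (u , v) → cong₂ long (output-pos u) (output-pos v)) outputEdges)
      (trans (∑-++ longᵛ kept (map (root ,_) reconnected))
        (cong₂ _+_ kept-short (reconnected-short reconnected))))
    where
    open SubdivideAndReconnect S
    longᵛ : Vertex n #steiner × Vertex n #steiner → ℕ
    longᵛ (u , v) = long (pos u) (pos v)

    output-pos : ∀ v → SteinerTree.pos output v ≡ pos v
    output-pos root        = refl
    output-pos (sink _)    = refl
    output-pos (steiner _) = refl

    edges-short : ∑ longᵛ deleted + ∑ longᵛ kept ≡ 0
    edges-short = begin
      ∑ longᵛ deleted + ∑ longᵛ kept ≡⟨ sym (∑-++ longᵛ deleted kept) ⟩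
      ∑ longᵛ (deleted ++ kept)      ≡⟨ sym (sum-↭ (map⁺ longᵛ subdivision)) ⟩
      ∑ longᵛ edges                  ≡⟨ cong sum (map-∘ edges) ⟩
      #long (placed tree)            ≡⟨ minimum⇒no-long {tree} isMinimumLength ⟩
      0                              ∎
      where open ≡-Reasoning

    root-short : ∀ p → long nothing p ≡ 0
    root-short nothing  = refl
    root-short (just _) = refl

    kept-short : ∑ longᵛ kept ≡ 0
    kept-short = m+n≡0⇒n≡0 (∑ longᵛ deleted) edges-short

    reconnected-short : ∀ vs → ∑ longᵛ (map (root ,_) vs) ≡ 0
    reconnected-short []       = refl
    reconnected-short (v ∷ vs) = cong₂ _+_ (root-short (pos v)) (reconnected-short vs)

  starParent : Fin n → Vertex n 0
  starParent zero    = root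
  starParent (suc _) = sink zero

  star-earlier : ∀ i → rank (starParent i) < rank {n} {0} (sink i)
  star-earlier zero    = s≤s z≤n
  star-earlier (suc _) = s≤s (s≤s z≤n)

  star-reach : ∀ i → Walk (ParentTree.edgesᵖ starParent star-earlier) root (sink i)
  star-reach zero    = ParentTree.parentEdge starParent star-earlier zero ◅ ε
  star-reach (suc i) = ParentTree.parentEdge starParent star-earlier zero ◅
                       ParentTree.parentEdge starParent star-earlier (suc i) ◅ ε

  -- The competitor for the optimum: a single root edge, and every sink within D + a + 1 of the root
  -- along the tree.
  star : SteinerTree I
  star = parentTree starParent star-earlier star-reach

  scaledCost-star : scaledCost star ≤ K * (D + n′ * suc a) + n * (D + suc a)
  scaledCost-star = +-mono-≤
    (*-monoʳ-≤ K (parentTree-len starParent star-earlier star-reach refl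
        (λ i → link≤suc-a (suc (toℕ i)))))
    (≤-trans (∑-mono (λ t → ≤-trans (parentTree-path starParent star-earlier star-reach t)
        (short-reach t)) (allFin n))
      (≤-reflexive (trans (∑-const (D + suc a) (allFin n))
          (cong (_* (D + suc a)) (length-tabulate {n = n} id)))))
    where
    short-reach : ∀ t → walkSum w⁰ (star-reach t) ≤ D + suc a
    short-reach zero    = +-monoʳ-≤ D z≤n
    short-reach (suc i) = +-monoʳ-≤ D
        (≤-trans (≤-reflexive (+-identityʳ _)) (link≤suc-a (suc (toℕ i))))

  -- If no tree were optimal, each would have a strictly cheaper one, against well-foundedness of
  -- `_<_` on scaled costs.
  optimum-exists : ¬ ¬ (∃ λ B → IsOptimal I B)
  optimum-exists none = search star (<-wellFounded (scaledCost star))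
    where
    search : ∀ B → ¬ Acc _<_ (scaledCost B)
    search B (acc smaller) = none (B , λ C →
      ≐⇒≤ℝ {SteinerTree.totalCost B} {SteinerTree.totalCost C} (totalCost≐ B) (totalCost≐ C)
        (≮⇒≥ λ C<B → search C (smaller C<B)))

  ratio-bound : ∀ {alg α} → HasApproximationRatio alg α →
    ¬ ¬ (∃ λ o → ∃ λ b → n * a * (3 * K + 1) ≤ o × b ≤ K * (D + n′ * suc a) + n * (D + suc a) ×
      (Eventually λ i → ι o ℚ.≤ seq α i ℚ.* ι b ℚ.+ 1ℚ))
  ratio-bound {alg} {α} ratio none = optimum-exists λ (B , optimal) →
    let S = alg I (spine , spine-minimum)
        A = SubdivideAndReconnect.output S
        N , p = ratio I (spine , spine-minimum) B optimal 1ℚ (ℚ.positive⁻¹ 1ℚ)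
    in none (scaledCost A , scaledCost B , scaledCost-bound A (output-no-long S) ,
      ≤-trans (≤ℝ⇒≤ {SteinerTree.totalCost B} {SteinerTree.totalCost star} (totalCost≐ B)
          (totalCost≐ star) (optimal star)) scaledCost-star ,
      N , λ i N≤i → ℚ.≤-trans (ℚ.≤-reflexive (sym (totalCost≐ A i)))
        (ℚ.≤-trans (p i N≤i) (ℚ.≤-reflexive (cong (λ x → seq α i ℚ.* x ℚ.+ 1ℚ) (totalCost≐ B i)))))

-- Arithmetic of the ratio 3/2

3/2 : ℚ
3/2 = ℤ.+ 3 ℚ./ 2

opaque
  unfolding ι

  2*3/2 : ι 2 ℚ.* 3/2 ≡ ι 3
  2*3/2 = refl

-- Multiply o ≤ x b + 1 by 2 q and add 2 b ≤ 2 b e q: then `x` and `e` occur only in the sum x + e ≤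
-- 3/2.
clear-denominators : ∀ x e q o b → x ℚ.+ e ℚ.≤ 3/2 → 1ℚ ℚ.≤ e ℚ.* ι q → ι o ℚ.≤ x ℚ.* ι b ℚ.+ 1ℚ →
  2 * q * o + 2 * b ≤ 3 * q * b + 2 * q
clear-denominators x e q o b x+e≤3/2 1≤eq o≤xb+1 = ι-cancel (begin
  ι (2 * q * o + 2 * b)
    ≡⟨ trans (ι-+ (2 * q * o) (2 * b))
        (cong₂ ℚ._+_ (ι-* (2 * q) o) (trans (ι-* 2 b) (sym (ℚ.*-identityʳ _)))) ⟩
  ι (2 * q) ℚ.* ι o ℚ.+ ι 2 ℚ.* ι b ℚ.* 1ℚ
    ≤⟨ ℚ.+-mono-≤ (ℚ.*-monoˡ-≤-nonNeg (ι (2 * q)) {{ι-nonNeg (2 * q)}} o≤xb+1)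
         (ℚ.*-monoˡ-≤-nonNeg (ι 2 ℚ.* ι b)
           {{ℚ.nonNeg*nonNeg⇒nonNeg (ι 2) {{ι-nonNeg 2}} (ι b) {{ι-nonNeg b}}}} 1≤eq) ⟩
  ι (2 * q) ℚ.* (x ℚ.* ι b ℚ.+ 1ℚ) ℚ.+ ι 2 ℚ.* ι b ℚ.* (e ℚ.* ι q)
    ≡⟨ cong (λ y → y ℚ.* (x ℚ.* ι b ℚ.+ 1ℚ) ℚ.+ ι 2 ℚ.* ι b ℚ.* (e ℚ.* ι q)) (ι-* 2 q) ⟩
  ι 2 ℚ.* ι q ℚ.* (x ℚ.* ι b ℚ.+ 1ℚ) ℚ.+ ι 2 ℚ.* ι b ℚ.* (e ℚ.* ι q)
    ≡⟨ solve 5 (λ t q b x e → t :* q :* (x :* b :+ con 1ℚ) :+ t :* b :* (e :* q)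
         := t :* q :* b :* (x :+ e) :+ t :* q) refl (ι 2) (ι q) (ι b) x e ⟩
  ι 2 ℚ.* ι q ℚ.* ι b ℚ.* (x ℚ.+ e) ℚ.+ ι 2 ℚ.* ι q
    ≤⟨ ℚ.+-monoˡ-≤ (ι 2 ℚ.* ι q) (ℚ.*-monoˡ-≤-nonNeg (ι 2 ℚ.* ι q ℚ.* ι b)
         {{ℚ.nonNeg*nonNeg⇒nonNeg (ι 2 ℚ.* ι q)
           {{ℚ.nonNeg*nonNeg⇒nonNeg (ι 2) {{ι-nonNeg 2}} (ι q) {{ι-nonNeg q}}}}
               (ι b) {{ι-nonNeg b}}}} x+e≤3/2) ⟩
  ι 2 ℚ.* ι q ℚ.* ι b ℚ.* 3/2 ℚ.+ ι 2 ℚ.* ι q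
    ≡⟨ solve 4 (λ t q b h → t :* q :* b :* h :+ t :* q := t :* h :* q :* b :+ t :* q) refl (ι 2)
        (ι q) (ι b) 3/2 ⟩
  ι 2 ℚ.* 3/2 ℚ.* ι q ℚ.* ι b ℚ.+ ι 2 ℚ.* ι q
    ≡⟨ cong₂ (λ y z → y ℚ.* ι q ℚ.* ι b ℚ.+ z) 2*3/2 (sym (ι-* 2 q)) ⟩
  ι 3 ℚ.* ι q ℚ.* ι b ℚ.+ ι (2 * q)
    ≡⟨ sym (trans (ι-+ (3 * q * b) (2 * q))
         (cong (ℚ._+ ι (2 * q)) (trans (ι-* (3 * q) b) (cong (ℚ._* ι b) (ι-* 3 q))))) ⟩
  ι (3 * q * b + 2 * q) ∎)
  where
  open ℚ.≤-Reasoning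
  open ℚ.+-*-Solver

-- With K = 4 (p + 1), the bounds on o and b are those for n = K², a = K.
no-ratio : ∀ p {o b} → let K = 4 + 4 * p in
  K * K * K * (3 * K + 1) ≤ o → b ≤ 2 * (K * K * (suc K * suc K)) →
  ¬ (2 * suc p * o + 2 * b ≤ 3 * suc p * b + 2 * suc p)
no-ratio p {o} {b} o≥ b≤ le = <⇒≱ gap (begin
  2 * suc p * (K * K * K * (3 * K + 1))           ≤⟨ *-monoʳ-≤ (2 * suc p) o≥ ⟩
  2 * suc p * o                                   ≤⟨ +-cancelʳ-≤ (2 * b) _ _
      (≤-trans le (≤-reflexive (split-3q p b))) ⟩
  (1 + 3 * p) * b + 2 * suc p                     ≤⟨ +-monoˡ-≤ (2 * suc p)
      (*-monoʳ-≤ (1 + 3 * p) b≤) ⟩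
  (1 + 3 * p) * (2 * (K * K * (suc K * suc K))) + 2 * suc p ∎)
  where
  open ≤-Reasoning
  open +-*-Solver
  -- With q = `suc p`, a gain of 4 K⁴ stands against a loss of about 10 q K³, which K = 4 q
  -- outweighs.
  K = 4 + 4 * p
  split-3q : ∀ p b → 3 * suc p * b + 2 * suc p ≡ (1 + 3 * p) * b + 2 * suc p + 2 * b
  split-3q = solve 2 (λ p b → con 3 :* (con 1 :+ p) :* b :+ con 2 :* (con 1 :+ p)
    := (con 1 :+ con 3 :* p) :* b :+ con 2 :* (con 1 :+ p) :+ con 2 :* b) refl
  -- One less than the difference of the two sides of `gap`, expanded in `p`; no coefficient is
  -- negative.
  excess = 861 + 2910 * p + 3616 * (p * p) + 1952 * (p * p * p) + 384 * (p * p * p * p)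
  gap : (1 + 3 * p) * (2 * (K * K * (suc K * suc K))) + 2 * suc p
        < 2 * suc p * (K * K * K * (3 * K + 1))
  gap = ≤-trans (m≤m+n _ excess) (≤-reflexive (solve 1 (λ p →
    let K = con 4 :+ con 4 :* p ; q = con 1 :+ p in
    con 1 :+ ((con 1 :+ con 3 :* p) :* (con 2 :* (K :* K :* ((con 1 :+ K) :* (con 1 :+ K))))
              :+ con 2 :* q)
      :+ (con 861 :+ con 2910 :* p :+ con 3616 :* (p :* p)
          :+ con 1952 :* (p :* p :* p) :+ con 384 :* (p :* p :* p :* p))
    := con 2 :* q :* (K :* K :* K :* (con 3 :* K :+ con 1))) refl p))

-- The instances with n = K² and a = K.
square-instance : ∀ {alg α} → HasApproximationRatio alg α → ∀ k → let K = suc k in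
  ¬ ¬ (∃ λ o → ∃ λ b → K * K * K * (3 * K + 1) ≤ o × b ≤ 2 * (K * K * (suc K * suc K)) ×
    (Eventually λ i → ι o ℚ.≤ seq α i ℚ.* ι b ℚ.+ 1ℚ))
square-instance {alg} {α} ratio k none =
  ratio-bound {alg} {α} ratio λ (o , b , o≥ , b≤ , eventually) →
    none (o , b , o≥ , ≤-trans b≤ star≤ , eventually)
  where
  -- The predecessor of K * K in the form to which the product unfolds, so that `n` computes to
  -- `K * K`.
  n′ = k + k * suc k
  open LowerBound k n′ k
  open Positions k n′ k
  star≤ : K * (D + n′ * suc a) + n * (D + suc a) ≤ 2 * (K * K * (suc K * suc K))
  star≤ = ≤-trans (+-monoˡ-≤ (n * (D + suc a))
      (*-monoʳ-≤ K (+-monoʳ-≤ D (*-monoˡ-≤ (suc a) (n≤1+n n′)))))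
    (≤-reflexive (solve 1 (λ K → K :* (K :* (con 1 :+ K) :+ K :* K :* (con 1 :+ K))
        :+ K :* K :* (K :* (con 1 :+ K) :+ (con 1 :+ K))
      := con 2 :* (K :* K :* ((con 1 :+ K) :* (con 1 :+ K)))) refl K))
    where open +-*-Solver

theorem5p1 : (alg : SubdivisionAlgorithm) (α : ℝ) →
    α <ℝ 3/2ℝ → ¬ HasApproximationRatio alg α
theorem5p1 alg α (e , e>0 , N , α+e≤3/2) ratio =
  let p , 1≤eq = archimedean e {{ℚ.positive e>0}} in
  -- The argument is the predecessor of K = 4 (p + 1), where p + 1 is at least 1/e.
  square-instance {alg} {α} ratio (3 + 4 * p) λ (o , b , o≥ , b≤ , M , o≤αb+1) →
    let i = N ⊔ M in
    no-ratio p o≥ b≤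
      (clear-denominators (seq α i) e (suc p) o b
        (α+e≤3/2 i (m≤m⊔n N M)) 1≤eq (o≤αb+1 i (m≤n⊔m N M)))
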